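{- Let $n$ be a Carmichael number. If any of the following groups exists, then there is no integer $k\geq 2$ with $k\varphi(n)=n-1$: (i) a noncyclic group $G$ of order $2n$ with $\psi''(G)>\frac{13}{42}$; (ii) a noncyclic group $G$ of order $4n$ with $\psi''(G)>\frac{7}{24}$; (iii) a noncyclic group $G$ of order $8n$ with $\psi''(G)>\frac{9}{32}$; (iv) for some integer $\alpha\geq 4$, a noncyclic group $G$ of order $2^{\alpha}n$ with $$\psi''(G)>\frac{16}{63}+\frac{1}{9\cdot 2^{2\alpha-1}}.$$
   Context: A composite positive integer $n$ is a Carmichael number if $b^n\equiv b\pmod n$ for every integer $b$ (equivalently, $n$ is squarefree and $(p-1)\mid(n-1)$ for every prime $p\mid n$). For a finite group $G$, $\psi(G):=\sum_{x\in G}\operatorname{ord}(x)$ and $\psi''(G):=\psi(G)/|G|^2$. $\varphi$ is Euler's totient function. -}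

module Defs where

open import Data.Nat as ℕ using (ℕ; zero; suc; _*_; _^_; _∸_; NonZero)
open import Data.Nat.Properties using (m*n≢0; m^n≢0)
open import Data.Nat.GCD using (gcd)
open import Data.Nat.Primality using (Composite)
open import Data.Integer as ℤ using (ℤ; +_)
open import Data.Integer.Divisibility as ℤD using ()
open import Data.Rational as ℚ using (ℚ)
open import Data.Fin using (Fin) renaming (_≟_ to _≟ᶠ_)
open import Data.List using (List; map; length; filter; upTo; allFin)
open import Data.Nat.ListAction using (sum)
open import Data.Product using (Σ; ∃; _×_)
open import Algebra.Core using (Op₁; Op₂)
open import Algebra.Structures using (IsGroup)
open import Relation.Binary.PropositionalEquality using (_≡_)
open import Relation.Nullary using (yes; no; ¬_)

Carmichael : ℕ → Set
Carmichael n = Composite n × (∀ (b : ℤ) → (+ n) ℤD.∣ (b ℤ.^ n ℤ.- b))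

φ : ℕ → ℕ
φ n = length (filter (λ k → gcd k n ℕ.≟ 1) (map suc (upTo n)))

-- A finite group of order m: a group structure on Fin m
-- (every finite group of order m is isomorphic to one of these).
record FinGroup (m : ℕ) : Set where
  field
    _∙_     : Op₂ (Fin m)
    ε       : Fin m
    _⁻¹     : Op₁ (Fin m)
    isGroup : IsGroup _≡_ _∙_ ε _⁻¹

  pow : Fin m → ℕ → Fin m
  pow x zero    = ε
  pow x (suc k) = x ∙ pow x k

  ordFrom : Fin m → ℕ → ℕ → ℕ
  ordFrom x zero       k = k
  ordFrom x (suc fuel) k with pow x k ≟ᶠ ε
  ... | yes _ = k
  ... | no  _ = ordFrom x fuel (suc k)

  -- order of x: least k ≥ 1 with x^k = ε (it is ≤ m, so the search suffices)
  ord : Fin m → ℕ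
  ord x = ordFrom x m 1

  Cyclic : Set
  Cyclic = ∃ λ g → ∀ x → ∃ λ k → pow g k ≡ x

open FinGroup public using (ord; Cyclic)

ψ : ∀ {m} → FinGroup m → ℕ
ψ {m} G = sum (map (ord G) (allFin m))

-- ψ''(G) = ψ(G) / |G|^2   (order 0 cannot occur for a group; value 0 there)
ψ'' : ∀ {m} → FinGroup m → ℚ
ψ'' {zero}  G = ℚ.0ℚ
ψ'' {suc m} G = (+ ψ G) ℚ./ (suc m ^ 2)

boundIV : ℕ → ℚ
boundIV α = (+ 16 ℚ./ 63) ℚ.+ ((+ 1) ℚ./ (9 * 2 ^ (2 * α ∸ 1)))
  {{m*n≢0 9 (2 ^ (2 * α ∸ 1)) {{_}} {{m^n≢0 2 (2 * α ∸ 1)}}}}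

NoncyclicAbove : ℕ → ℚ → Set
NoncyclicAbove m q = Σ (FinGroup m) λ G → ¬ Cyclic G × ψ'' G ℚ.> q

{-# OPTIONS --safe #-}

-- Since every bound exceeds 1/4, some x has order greater than |G| / 4, so ⟨ x ⟩ has index 2 or 3.
-- Let n′ be the largest divisor of n prime to 3 and z the power of x of order n′, and average
-- ord over the cosets y⟨ z ⟩.  If y commutes with z, the coset contains some u with z ∈ ⟨ u ⟩, and
-- its elements are the u ^ (1 + F j): φ(n′) of them have order at most ord u ≤ |G| / 2 and the
-- others at most a fifth of that, as n′ is prime to 6.  If y does not commute with z, then
-- ord y ≤ |G| / 5.  Lehmer's equation gives φ(n) < n / 2, and modulo 3 even φ(n′) < 3 n′ / 8
-- when 3 ∣ n.  This bounds ψ''(G) by 1/4 if 3 ∣ n or z is not central.  Otherwise it gives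
-- 3/10; the elements killed by |G| / 4, respectively |G| / 8, improve it to 21/80 and 81/320.

module Submission where

open import Defs
open import Data.Nat using (ℕ; zero; suc; pred; _+_; _*_; _^_; _∸_; _≤_; _<_; _≥_; z≤n; s≤s; s≤s⁻¹;
  NonZero; >-nonZero; >-nonZero⁻¹; nonTrivial⇒n>1)
open import Data.Rational using (_/_)
open import Data.Integer using (+_)
open import Data.Product using (Σ; ∃; ∃₂; _×_; _,_; proj₁; proj₂)
open import Data.Sum using (_⊎_; inj₁; inj₂)
open import Relation.Binary.PropositionalEquality
open import Relation.Nullary using (Dec; yes; no; ¬_; contradiction)

open import Algebra.Bundles using (Group)
open import Data.Empty using (⊥)
open import Data.Fin using (Fin; zero; suc; toℕ; fromℕ<; combine; remQuot) renaming (_≟_ to _≟ᶠ_)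
open import Data.Fin.Permutation using (Permutation; permutation)
import Data.Fin.Properties as Fin
open import Data.Integer as ℤ using (-[1+_])
import Data.Integer.Properties as ℤ
open import Data.List using (List; []; _∷_; map; filter; length; applyUpTo; tabulate; allFin)
open import Data.List.Properties using (map-tabulate)
open import Data.List.Relation.Unary.All using (All; []; _∷_)
open import Data.Nat.Coprimality using (Coprime; coprime⇒gcd≡1; gcd≡1⇒coprime; coprime-divisor; coprime-Bézout)
import Data.Nat.Coprimality as Coprimality
open import Data.Nat.DivMod using (_%_; m≡m%n+[m/n]*n; m%n<n) renaming (_/_ to _÷_)
open import Data.Nat.Divisibility
open import Data.Nat.GCD using (gcd; gcd[m,n]∣m; gcd[m,n]∣n; module Bézout)
open import Data.Nat.ListAction using (product) renaming (sum to sumList)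
open import Data.Nat.Primality using (Prime; prime; prime?; prime⇒irreducible; prime⇒nonZero;
  prime⇒nonTrivial; composite; composite⇒nonTrivial)
open import Data.Nat.Primality.Factorisation using (factorise)
open import Data.Nat.Properties
open import Data.Nat.Tactic.RingSolver using (solve-∀)
import Data.Rational as ℚ
import Data.Rational.Properties as ℚ
import Data.Rational.Unnormalised as ℚᵘ
import Data.Rational.Unnormalised.Properties as ℚᵘ
open import Function using (_∘_; id)
open import Function.Definitions using (Injective)
open import Level using (0ℓ)
open import Relation.Binary.Definitions using (tri<; tri≈; tri>)
open import Relation.Nullary.Decidable using (from-yes)
open import Relation.Unary using (Pred; Decidable)
open import Algebra.Properties.CommutativeMonoid.Sum +-0-commutativeMonoid
  using (sum; sum-syntax; sum-cong-≗; sum-permute; ∑-comm; ∑-distrib-+)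
open import Algebra.Properties.Semiring.Sum +-*-semiring using (*-distribˡ-sum)

-- Finite sums and counting

-- Since ⟨ x ⟩ has index at most 3, every y has a power y ^ i in ⟨ x ⟩ with 1 ≤ i ≤ 3, and such an i
-- is sure to be invertible only modulo numbers prime to 6. Hence n′ leaves out the factor 3 and n
-- has to be odd. Arithmetic of exponents modulo n′ takes the place of any structure theory of G.
-- The constants, in units of |G|: a commuting coset averages at most 1/2 * (1/2 + 1/2 * 1/5) = 3/10
-- if φ(n′) ≤ n′ / 2, and at most 1/2 * (3/8 + 5/8 * 1/5) = 1/4 if φ(n′) ≤ 3 n′ / 8. If z is not
-- central, at least half of the elements fail to commute with it, and the mean of 3/10 and 1/5 is
-- again 1/4. If z is central, the bound 3/10 drops to 3/20 for elements killed by |G| / 4 and to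
-- 3/40 for those killed by |G| / 8; they make up at least a quarter and an eighth of G. So 21/80 =
-- 3/4 * 3/10 + 1/4 * 3/20 and 81/320 = 3/4 * 3/10 + 1/8 * 3/20 + 1/8 * 3/40. The threshold 16/63
-- lies between these two values, which is why case (iv) calls for the second refinement.

𝟙 : ∀ {a} {A : Set a} → Dec A → ℕ
𝟙 (yes _) = 1
𝟙 (no  _) = 0

∑-mono : ∀ {n} {f g : Fin n → ℕ} → (∀ i → f i ≤ g i) → sum f ≤ sum g
∑-mono {zero}  f≤g = z≤n
∑-mono {suc n} f≤g = +-mono-≤ (f≤g zero) (∑-mono (f≤g ∘ suc))

∑-const : ∀ n {c} → ∑[ i < n ] c ≡ n * c
∑-const zero    = refl
∑-const (suc n) {c} = cong (λ s → c + s) (∑-const n)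

∑-≤-const : ∀ {n} {f : Fin n → ℕ} {c} → (∀ i → f i ≤ c) → sum f ≤ n * c
∑-≤-const {n} f≤c = ≤-trans (∑-mono f≤c) (≤-reflexive (∑-const n))

∑-scale : ∀ {n} c (f : Fin n → ℕ) → c * sum f ≡ ∑[ i < n ] (c * f i)
∑-scale c f = *-distribˡ-sum c f

∑-list : ∀ {n} (f : Fin n → ℕ) → sumList (map f (allFin n)) ≡ sum f
∑-list f = trans (cong sumList (map-tabulate id f)) (go f)
  where
  go : ∀ {n} (f : Fin n → ℕ) → sumList (tabulate f) ≡ sum f
  go {zero}  f = refl
  go {suc n} f = cong (λ s → f zero + s) (go (f ∘ suc))

∑-𝟙-≤1 : ∀ {m} {p} {P : Fin m → Set p} (P? : ∀ i → Dec (P i)) →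
         (∀ {i j} → P i → P j → i ≡ j) → ∑[ i < m ] 𝟙 (P? i) ≤ 1
∑-𝟙-≤1 {zero}  P? unique = z≤n
∑-𝟙-≤1 {suc m} {P = P} P? unique with P? zero
... | yes p₀ = s≤s (≤-trans (∑-mono none) (≤-reflexive (trans (∑-const m) (*-zeroʳ m))))
  where
  none : ∀ i → 𝟙 (P? (suc i)) ≤ 0
  none i with P? (suc i)
  ... | yes pᵢ with () ← unique p₀ pᵢ
  ... | no  _  = z≤n
... | no  _  = ∑-𝟙-≤1 (P? ∘ suc) λ p q → Fin.suc-injective (unique p q)

∑-δ : ∀ {n} (i : Fin n) → ∑[ j < n ] 𝟙 (i ≟ᶠ j) ≡ 1
∑-δ {n} i = ≤-antisym (∑-𝟙-≤1 (i ≟ᶠ_) λ p q → trans (sym p) q) (go i)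
  where
  diag : ∀ {n} (i : Fin n) → 𝟙 (i ≟ᶠ i) ≡ 1
  diag i with i ≟ᶠ i
  ... | yes _ = refl
  ... | no ¬p = contradiction refl ¬p
  term≤∑ : ∀ {n} (f : Fin n → ℕ) i → f i ≤ sum f
  term≤∑ f zero    = m≤m+n _ _
  term≤∑ f (suc i) = ≤-trans (term≤∑ (f ∘ suc) i) (m≤n+m _ _)
  go : ∀ {n} (i : Fin n) → 1 ≤ ∑[ j < n ] 𝟙 (i ≟ᶠ j)
  go i = subst (_≤ sum (λ j → 𝟙 (i ≟ᶠ j))) (diag i) (term≤∑ (λ j → 𝟙 (i ≟ᶠ j)) i)

-- Double counting of the pairs `(i , y)` with `f i ≡ y`: each `i` occurs in exactly one, and by
-- injectivity each `y` in at most one, which requires `P y`.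
injection⇒≤-count : ∀ {m n p} {P : Fin n → Set p} (P? : ∀ y → Dec (P y)) {f : Fin m → Fin n} →
                    Injective _≡_ _≡_ f → (∀ i → P (f i)) → m ≤ ∑[ y < n ] 𝟙 (P? y)
injection⇒≤-count {m} {n} P? {f} inj Pf = begin
  m                                        ≡⟨ *-identityʳ m ⟨
  m * 1                                    ≡⟨ ∑-const m ⟨
  ∑[ i < m ] 1                             ≡⟨ sum-cong-≗ (λ i → ∑-δ (f i)) ⟨
  ∑[ i < m ] ∑[ y < n ] 𝟙 (f i ≟ᶠ y)       ≡⟨ ∑-comm (λ i y → 𝟙 (f i ≟ᶠ y)) ⟩
  ∑[ y < n ] ∑[ i < m ] 𝟙 (f i ≟ᶠ y)       ≤⟨ ∑-mono fibre ⟩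
  ∑[ y < n ] 𝟙 (P? y)                      ∎
  where
  open ≤-Reasoning
  fibre : ∀ y → ∑[ i < m ] 𝟙 (f i ≟ᶠ y) ≤ 𝟙 (P? y)
  fibre y with P? y
  ... | yes _ = ∑-𝟙-≤1 (λ i → f i ≟ᶠ y) λ p q → inj (trans p (sym q))
  ... | no ¬p = ≤-trans (∑-mono none) (≤-reflexive (trans (∑-const m) (*-zeroʳ m)))
    where
    none : ∀ i → 𝟙 (f i ≟ᶠ y) ≤ 0
    none i with f i ≟ᶠ y
    ... | yes refl = contradiction (Pf i) ¬p
    ... | no  _    = z≤n

-- Summands live on all of ℕ, so that ranges can be shifted and cut into blocks without casts
-- between `Fin` types.
∑< : ℕ → (ℕ → ℕ) → ℕ
∑< n f = ∑[ i < n ] f (toℕ i)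

∑<-cong : ∀ n {f g : ℕ → ℕ} → (∀ j → f j ≡ g j) → ∑< n f ≡ ∑< n g
∑<-cong n f≗g = sum-cong-≗ {n} (f≗g ∘ toℕ)

∑<-last : ∀ n f → ∑< (suc n) f ≡ ∑< n f + f n
∑<-last zero    f = +-identityʳ (f 0)
∑<-last (suc n) f = trans (cong (λ s → f 0 + s) (∑<-last n (f ∘ suc))) (sym (+-assoc (f 0) _ _))

∑<-+ : ∀ m n f → ∑< (m + n) f ≡ ∑< m f + ∑< n (λ j → f (m + j))
∑<-+ zero    n f = refl
∑<-+ (suc m) n f = trans (cong (λ s → f 0 + s) (∑<-+ m n (f ∘ suc))) (sym (+-assoc (f 0) _ _))

∑<-* : ∀ m n f → ∑< (m * n) f ≡ ∑< m (λ l → ∑< n (λ j → f (l * n + j)))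
∑<-* zero    n f = refl
∑<-* (suc m) n f = trans (∑<-+ n (m * n) f) (cong (λ s → ∑< n f + s)
  (trans (∑<-* m n (λ j → f (n + j)))
    (∑<-cong m λ l → ∑<-cong n λ j → cong f (sym (+-assoc n (l * n) j)))))

∑<-shift : ∀ n t {f : ℕ → ℕ} → (∀ j → f (n + j) ≡ f j) → ∑< n (λ j → f (t + j)) ≡ ∑< n f
∑<-shift n zero    per = refl
∑<-shift n (suc t) {f} per = begin
  ∑< n (λ j → f (suc t + j))  ≡⟨ ∑<-shift n t {f ∘ suc} (λ j → trans (cong f (sym (+-suc n j))) (per (suc j))) ⟩
  ∑< n (f ∘ suc)              ≡⟨ +-cancelˡ-≡ (f 0) _ _ wrap ⟩
  ∑< n f                      ∎
  where
  open ≡-Reasoning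
  -- The sum of `f` over the first `suc n` arguments, split off at the front and at the back; the
  -- two extra terms `f 0` and `f n` agree by periodicity.
  wrap : f 0 + ∑< n (f ∘ suc) ≡ f 0 + ∑< n f
  wrap = begin
    ∑< (suc n) f        ≡⟨ ∑<-last n f ⟩
    ∑< n f + f n        ≡⟨ cong (λ s → ∑< n f + s) (trans (cong f (sym (+-identityʳ n))) (per 0)) ⟩
    ∑< n f + f 0        ≡⟨ +-comm _ (f 0) ⟩
    f 0 + ∑< n f        ∎

-- Euler's totient at p m

-- The principal Dirichlet character modulo `m`, with values in ℕ.
χ : ℕ → ℕ → ℕ
χ m k = 𝟙 (gcd k m ≟ 1)

length-filter-applyUpTo : ∀ {p} {P : Pred ℕ p} (P? : Decidable P) (h : ℕ → ℕ) n →
  length (filter P? (map suc (applyUpTo h n))) ≡ ∑< n (λ j → 𝟙 (P? (suc (h j))))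
length-filter-applyUpTo P? h zero    = refl
length-filter-applyUpTo P? h (suc n) with P? (suc (h 0))
... | yes _ = cong suc (length-filter-applyUpTo P? (h ∘ suc) n)
... | no  _ = length-filter-applyUpTo P? (h ∘ suc) n

φ-∑ : ∀ n → φ n ≡ ∑< n (χ n ∘ suc)
φ-∑ n = length-filter-applyUpTo (λ k → gcd k n ≟ 1) id n

χ-cases : ∀ m k → χ m k ≡ 1 ⊎ (χ m k ≡ 0 × gcd k m ≢ 1)
χ-cases m k with gcd k m ≟ 1
... | yes _ = inj₁ refl
... | no ¬p = inj₂ (refl , ¬p)

χ-cong : ∀ m k m′ k′ → (Coprime k m → Coprime k′ m′) → (Coprime k′ m′ → Coprime k m) →
         χ m k ≡ χ m′ k′
χ-cong m k m′ k′ to from with gcd k m ≟ 1 | gcd k′ m′ ≟ 1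
... | yes _ | yes _ = refl
... | no  _ | no  _ = refl
... | yes p | no ¬q = contradiction (coprime⇒gcd≡1 (to (gcd≡1⇒coprime p))) ¬q
... | no ¬p | yes q = contradiction (coprime⇒gcd≡1 (from (gcd≡1⇒coprime q))) ¬p

χ-periodic : ∀ m k → χ m (m + k) ≡ χ m k
χ-periodic m k = χ-cong m (m + k) m k
  (λ c (d∣k , d∣m) → c (∣m∣n⇒∣m+n d∣m d∣k , d∣m))
  (λ c (d∣m+k , d∣m) → c (∣m+n∣m⇒∣n d∣m+k d∣m , d∣m))

prime∤⇒coprime : ∀ {p k} → Prime p → p ∤ k → Coprime k p
prime∤⇒coprime pp p∤k (d∣k , d∣p) with prime⇒irreducible pp d∣p
... | inj₁ d≡1  = d≡1
... | inj₂ refl = contradiction d∣k p∤k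

coprime-* : ∀ {k a b} → Coprime k a → Coprime k b → Coprime k (a * b)
coprime-* ka kb (d∣k , d∣ab) =
  kb (d∣k , coprime-divisor (λ (e∣d , e∣a) → ka (∣-trans e∣d d∣k , e∣a)) d∣ab)

coprime-inverse : ∀ {a n} → 1 < n → Coprime a n → ∃ λ w → ∃ λ q → a * w ≡ 1 + q * n
coprime-inverse {a} {n} 1<n c with coprime-Bézout c
... | Bézout.+- w q eq = w , q , trans (*-comm a w) (sym eq)
-- Here `w * a` is -1 modulo `n`. Its square is 1, so `w * (a * w)` serves as the inverse.
... | Bézout.-+ w q eq with w * a in t≡
...   | zero  = contradiction (sym (m*n≡1⇒n≡1 q n (sym eq))) (<⇒≢ 1<n)
...   | suc t = w * (a * w) , t * q , (begin
  a * (w * (a * w))  ≡⟨ identity₁ a w ⟩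
  (w * a) * (w * a)  ≡⟨ cong₂ _*_ t≡ t≡ ⟩
  suc t * suc t      ≡⟨ identity₂ t ⟩
  1 + t * (2 + t)    ≡⟨ cong (λ l → 1 + t * l) eq ⟩
  1 + t * (q * n)    ≡⟨ cong suc (*-assoc t q n) ⟨
  1 + t * q * n      ∎)
  where
  open ≡-Reasoning
  identity₁ : ∀ a w → a * (w * (a * w)) ≡ (w * a) * (w * a)
  identity₁ = solve-∀
  identity₂ : ∀ t → suc t * suc t ≡ 1 + t * (2 + t)
  identity₂ = solve-∀

χ-*-prime : ∀ {p} m k → Prime p → χ m k ≡ χ (p * m) k + 𝟙 (p ∣? k) * χ m k
χ-*-prime {p} m k pp with p ∣? k
χ-*-prime {p} m k pp | yes p∣k with gcd k (p * m) ≟ 1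
... | yes q = contradiction (gcd≡1⇒coprime q (p∣k , m∣m*n m)) λ { refl → case-1 pp }
  where
  case-1 : ¬ Prime 1
  case-1 (prime {{()}} _)
... | no  _ = sym (+-identityʳ _)
χ-*-prime {p} m k pp | no p∤k = trans
  (χ-cong m k (p * m) k (coprime-* (prime∤⇒coprime pp p∤k))
    (λ c (d∣k , d∣m) → c (d∣k , ∣n⇒∣m*n p d∣m)))
  (sym (+-identityʳ _))

-- Cut the range into `m` blocks of length `p`. Because of the shift by `suc`, the multiple of `p`
-- in each block sits at its last index.
∑<-multiples : ∀ m p .{{_ : NonZero p}} (g : ℕ → ℕ) →
               ∑< (m * p) (λ j → 𝟙 (p ∣? suc j) * g (suc j)) ≡ ∑< m (λ l → g (suc l * p))
∑<-multiples m p@(suc p-1) g = trans (∑<-* m p (λ j → 𝟙 (p ∣? suc j) * g (suc j))) (∑<-cong m block)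
  where
  open ≡-Reasoning
  F : ℕ → ℕ → ℕ
  F l j = 𝟙 (p ∣? suc (l * p + j)) * g (suc (l * p + j))
  below : ∀ l (j : Fin p-1) → F l (toℕ j) ≡ 0
  below l j with p ∣? suc (l * p + toℕ j)
  ... | no  _   = refl
  ... | yes p∣s = contradiction (∣m+n∣m⇒∣n (subst (p ∣_) (sym (+-suc (l * p) (toℕ j))) p∣s) (n∣m*n l))
                    (>⇒∤ (s≤s (Fin.toℕ<n j)))
  top : ∀ l → F l p-1 ≡ g (suc l * p)
  top l rewrite sym (+-suc (l * p) p-1) | +-comm (l * p) p with p ∣? (p + l * p)
  ... | yes _ = +-identityʳ _
  ... | no ¬d = contradiction (n∣m*n (suc l)) ¬d
  block : ∀ l → ∑< p (F l) ≡ g (suc l * p)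
  block l = begin
    ∑< p (F l)               ≡⟨ ∑<-last p-1 (F l) ⟩
    ∑< p-1 (F l) + F l p-1   ≡⟨ cong (_+ F l p-1) (trans (sum-cong-≗ (below l)) (trans (∑-const p-1) (*-zeroʳ p-1))) ⟩
    F l p-1                  ≡⟨ top l ⟩
    g (suc l * p)            ∎

-- Both sides count the numbers from 1 to `p * m` that are prime to `m`. They fill `p` periods of
-- `χ m`; they also split into those prime to `p`, counted by `φ (p * m)`, and the multiples
-- `l * p`, where `l * p` is prime to `m` exactly when `l` is. The sum on the left avoids the factor
-- p - 1.
φ-*-prime : ∀ {p m} → Prime p → p ∤ m → φ (p * m) + φ m ≡ p * φ m
φ-*-prime {p} {m} pp p∤m = begin
  φ (p * m) + φ m
    ≡⟨ cong₂ _+_ (φ-∑ (p * m)) (trans (φ-∑ m) (trans (∑<-cong m strip) (sym (∑<-multiples m p (χ m))))) ⟩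
  ∑< (p * m) (χ (p * m) ∘ suc) + ∑< (m * p) B
    ≡⟨ cong (λ l → ∑< (p * m) (χ (p * m) ∘ suc) + ∑< l B) (*-comm m p) ⟩
  ∑< (p * m) (χ (p * m) ∘ suc) + ∑< (p * m) B
    ≡⟨ ∑-distrib-+ {p * m} (χ (p * m) ∘ suc ∘ toℕ) (B ∘ toℕ) ⟨
  ∑< (p * m) (λ j → χ (p * m) (suc j) + B j)
    ≡⟨ ∑<-cong (p * m) (λ j → sym (χ-*-prime m (suc j) pp)) ⟩
  ∑< (p * m) (χ m ∘ suc)
    ≡⟨ ∑<-* p m (χ m ∘ suc) ⟩
  ∑< p (λ l → ∑< m (λ j → χ m (suc (l * m + j))))
    ≡⟨ ∑<-cong p (λ l → ∑<-shift m (l * m) {χ m ∘ suc} periodic) ⟩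
  ∑< p (λ _ → ∑< m (χ m ∘ suc))
    ≡⟨ ∑-const p ⟩
  p * ∑< m (χ m ∘ suc)
    ≡⟨ cong (p *_) (φ-∑ m) ⟨
  p * φ m ∎
  where
  open ≡-Reasoning
  instance
    p≢0 : NonZero p
    p≢0 = prime⇒nonZero pp
  B : ℕ → ℕ
  B j = 𝟙 (p ∣? suc j) * χ m (suc j)
  periodic : ∀ j → χ m (suc (m + j)) ≡ χ m (suc j)
  periodic j = trans (cong (χ m) (sym (+-suc m j))) (χ-periodic m (suc j))
  strip : ∀ l → χ m (suc l) ≡ χ m (suc l * p)
  strip l = χ-cong m (suc l) m (suc l * p)
    (λ c → Coprimality.sym (coprime-* (Coprimality.sym c) (prime∤⇒coprime pp p∤m)))
    (λ c (d∣l , d∣m) → c (∣m⇒∣m*n p d∣l , d∣m))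

-- Carmichael numbers and Lehmer's equation

Squarefree : ℕ → Set
Squarefree n = ∀ {p} → Prime p → p * p ∤ n

+-^ : ∀ b k → (+ b) ℤ.^ k ≡ + (b ^ k)
+-^ b zero    = refl
+-^ b (suc k) = trans (cong ((+ b) ℤ.*_) (+-^ b k)) (sym (ℤ.pos-* b (b ^ k)))

carmichael-∣ : ∀ {n} → Carmichael n → ∀ b .{{_ : NonZero b}} → n ∣ b ^ n ∸ b
carmichael-∣ {n} (comp , n∣) b = subst (n ∣_) (begin
  ℤ.∣ (+ b) ℤ.^ n ℤ.- + b ∣  ≡⟨ cong (λ i → ℤ.∣ i ℤ.- + b ∣) (+-^ b n) ⟩
  ℤ.∣ + (b ^ n) ℤ.- + b ∣    ≡⟨ cong ℤ.∣_∣ (ℤ.m-n≡m⊖n (b ^ n) b) ⟩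
  ℤ.∣ b ^ n ℤ.⊖ b ∣          ≡⟨ cong ℤ.∣_∣ (ℤ.⊖-≥ b≤b^n) ⟩
  b ^ n ∸ b                  ∎) (n∣ (+ b))
  where
  open ≡-Reasoning
  b≤b^n : b ≤ b ^ n
  b≤b^n = ≤-trans (≤-reflexive (sym (^-identityʳ b)))
                  (^-monoʳ-≤ b (<⇒≤ (nonTrivial⇒n>1 n {{composite⇒nonTrivial comp}})))

-- Take `b = p`: if `p * p` divides `n`, it divides both `p ^ n ∸ p` and, as n ≥ 2, `p ^ n`, hence
-- also `p`.
carmichael⇒squarefree : ∀ {n} → Carmichael n → Squarefree n
carmichael⇒squarefree {n} car@(comp , _) {p} pp p²∣n =
  contradiction (∣⇒≤ p²∣p) (<⇒≱ (m<m*n p p (nonTrivial⇒n>1 p {{prime⇒nonTrivial pp}})))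
  where
  instance
    _ = prime⇒nonZero pp
  n>1 = nonTrivial⇒n>1 n {{composite⇒nonTrivial comp}}
  p²∣p^n : p * p ∣ p ^ n
  p²∣p^n = subst (p * p ∣_)
    (trans (*-assoc p p _) (cong (p ^_) (m+[n∸m]≡n n>1)))
    (m∣m*n (p ^ (n ∸ 2)))
  p²∣p : p * p ∣ p
  p²∣p = ∣m+n∣m⇒∣n (subst (p * p ∣_) (sym (m∸n+n≡m p≤p^n)) p²∣p^n) (∣-trans p²∣n (carmichael-∣ car p))
    where
    p≤p^n : p ≤ p ^ n
    p≤p^n = ≤-trans (≤-reflexive (sym (^-identityʳ p))) (^-monoʳ-≤ p (<⇒≤ n>1))

-- Apply b ^ n ≡ b to b = -1.
carmichael⇒odd : ∀ {n} → Carmichael n → 2 ∤ n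
carmichael⇒odd {n} (composite {d} d<n d∣n , n∣) (divides j refl) = go (∣⇒≤ n∣2)
  where
  n∣2 : n ∣ 2
  n∣2 = subst (λ i → n ∣ ℤ.∣ i ℤ.- -[1+ 0 ] ∣)
    (trans (cong (-[1+ 0 ] ℤ.^_) (*-comm j 2))
      (trans (sym (ℤ.^-*-assoc -[1+ 0 ] 2 j)) (ℤ.^-zeroˡ j)))
    (n∣ -[1+ 0 ])
  go : ¬ (n ≤ 2)
  go n≤2 = contradiction (nonTrivial⇒n>1 d) (<⇒≱ (<-≤-trans d<n n≤2))

mod-3 : ∀ m → ∃ λ b → m ≡ 3 * b ⊎ m ≡ 1 + 3 * b ⊎ m ≡ 2 + 3 * b
mod-3 m = m ÷ 3 , go (m % 3) (m%n<n m 3) (trans (m≡m%n+[m/n]*n m 3) (cong (λ x → m % 3 + x) (*-comm (m ÷ 3) 3)))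
  where
  go : ∀ r → r < 3 → m ≡ r + 3 * (m ÷ 3) → m ≡ 3 * (m ÷ 3) ⊎ m ≡ 1 + 3 * (m ÷ 3) ⊎ m ≡ 2 + 3 * (m ÷ 3)
  go 0 _ eq = inj₁ eq
  go 1 _ eq = inj₂ (inj₁ eq)
  go 2 _ eq = inj₂ (inj₂ eq)
  go (suc (suc (suc _))) (s≤s (s≤s (s≤s ()))) _

-- Each prime factor contributes p - 1 to `φ m`. The class p ≡ 0 (mod 3) is excluded by `3 ∤ m`, and
-- p ≡ 1 would make `φ m` divisible by 3. So every p ≡ 2, and every contribution is 1 modulo 3.
φ≡1mod3 : ∀ m .{{_ : NonZero m}} → Squarefree m → 3 ∤ m → 3 ∤ φ m → ∃ λ a → φ m ≡ 1 + 3 * a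
φ≡1mod3 m with record { factors = ps ; isFactorisation = refl ; factorsPrime = primes } ← factorise m = go ps primes
  where
  step : ∀ {p m a} → Prime p → p ∤ m → 3 ∤ p → 3 ∤ φ (p * m) → φ m ≡ 1 + 3 * a →
         ∃ λ a′ → φ (p * m) ≡ 1 + 3 * a′
  step {p} {m} {a} pp p∤m 3∤p 3∤φpm φm≡ = split (mod-3 p)
    where
    φpm≡ : φ (p * m) + (1 + 3 * a) ≡ p * (1 + 3 * a)
    φpm≡ = subst (λ x → φ (p * m) + x ≡ p * x) φm≡ (φ-*-prime pp p∤m)
    identity₁ : ∀ a b → (1 + 3 * b) * (1 + 3 * a) ≡ b * (1 + 3 * a) * 3 + (1 + 3 * a)
    identity₁ = solve-∀
    identity₂ : ∀ a b → (2 + 3 * b) * (1 + 3 * a) ≡ 1 + 3 * (b + a + 3 * a * b) + (1 + 3 * a)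
    identity₂ = solve-∀
    split : (∃ λ b → p ≡ 3 * b ⊎ p ≡ 1 + 3 * b ⊎ p ≡ 2 + 3 * b) → ∃ λ a′ → φ (p * m) ≡ 1 + 3 * a′
    split (b , inj₁ p≡) = contradiction (divides b (trans p≡ (*-comm 3 b))) 3∤p
    split (b , inj₂ (inj₁ p≡)) = contradiction (divides (b * (1 + 3 * a))
      (+-cancelʳ-≡ (1 + 3 * a) _ _ (trans φpm≡ (trans (cong (_* (1 + 3 * a)) p≡) (identity₁ a b))))) 3∤φpm
    split (b , inj₂ (inj₂ p≡)) = b + a + 3 * a * b ,
      +-cancelʳ-≡ (1 + 3 * a) _ _ (trans φpm≡ (trans (cong (_* (1 + 3 * a)) p≡) (identity₂ a b)))

  go : ∀ ps → All Prime ps → Squarefree (product ps) → 3 ∤ product ps → 3 ∤ φ (product ps) →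
       ∃ λ a → φ (product ps) ≡ 1 + 3 * a
  go []       []              _  _     _     = 0 , refl
  go (p ∷ ps) (pp ∷ primes) sf 3∤pm 3∤φpm =
    let a , φm≡ = go ps primes (λ qq q²∣m → sf qq (∣n⇒∣m*n p q²∣m)) (λ 3∣m → 3∤pm (∣n⇒∣m*n p 3∣m)) 3∤φm
    in step {a = a} pp p∤m (λ 3∣p → 3∤pm (∣m⇒∣m*n _ 3∣p)) 3∤φpm φm≡
    where
    p∤m : p ∤ product ps
    p∤m p∣m = sf pp (*-monoʳ-∣ p p∣m)
    3∤φm : 3 ∤ φ (product ps)
    3∤φm 3∣φm = 3∤φpm (∣m+n∣m⇒∣n (subst (3 ∣_)
      (trans (sym (φ-*-prime pp p∤m)) (+-comm (φ (p * product ps)) (φ (product ps)))) (∣n⇒∣m*n p 3∣φm)) 3∣φm)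

3-prime : Prime 3
3-prime = from-yes (prime? 3)

1+3*≢3* : ∀ a b → 1 + 3 * a ≢ 3 * b
1+3*≢3* a b eq = >⇒∤ {1} {3} (s≤s (s≤s z≤n))
  (∣m+n∣m⇒∣n (subst (3 ∣_) (trans (sym eq) (+-comm 1 (3 * a))) (m∣m*n b)) (m∣m*n a))

2+3*≢3* : ∀ a b → 2 + 3 * a ≢ 3 * b
2+3*≢3* a b eq = >⇒∤ {2} {3} (s≤s (s≤s (s≤s z≤n)))
  (∣m+n∣m⇒∣n (subst (3 ∣_) (trans (sym eq) (+-comm 2 (3 * a))) (m∣m*n b)) (m∣m*n a))

-- k φ(n) = n - 1 makes φ(m) prime to 3, so φ(m) ≡ 1 (mod 3) and then k ≢ 0, 2 (mod 3).
lehmer-multiple-of-3 : ∀ {k m} → Squarefree (3 * m) → k ≥ 2 → suc (k * φ (3 * m)) ≡ 3 * m →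
                       8 * φ m ≤ 3 * m
lehmer-multiple-of-3 {k} {zero} sf k≥2 ()
lehmer-multiple-of-3 {k} {m@(suc _)} sf k≥2 eq = go k k≥2 eq′
  where
  3∤m : 3 ∤ m
  3∤m 3∣m = sf 3-prime (*-monoʳ-∣ 3 3∣m)
  φ[3m] : φ (3 * m) ≡ 2 * φ m
  φ[3m] = +-cancelʳ-≡ (φ m) _ _ (trans (φ-*-prime 3-prime 3∤m) (+-comm (φ m) (2 * φ m)))
  eq′ : suc (k * (2 * φ m)) ≡ 3 * m
  eq′ = trans (cong (λ x → suc (k * x)) (sym φ[3m])) eq
  3∤φm : 3 ∤ φ m
  3∤φm (divides a φm≡) = 1+3*≢3* (k * (2 * a)) m
    (trans (cong suc (trans (identity k a) (cong (λ x → k * (2 * x)) (sym φm≡)))) eq′)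
    where
    identity : ∀ k a → 3 * (k * (2 * a)) ≡ k * (2 * (a * 3))
    identity = solve-∀
  φm≡1mod3 = φ≡1mod3 m (λ qq q²∣m → sf qq (∣n⇒∣m*n 3 q²∣m)) 3∤m 3∤φm
  go : ∀ k → k ≥ 2 → suc (k * (2 * φ m)) ≡ 3 * m → 8 * φ m ≤ 3 * m
  go 0 () _
  go 1 (s≤s ()) _
  go 2 _ e with a , φm≡ ← φm≡1mod3 = contradiction
    (trans (identity a) (trans (cong (λ x → suc (2 * (2 * x))) (sym φm≡)) e)) (2+3*≢3* (1 + 4 * a) m)
    where
    identity : ∀ a → 2 + 3 * (1 + 4 * a) ≡ suc (2 * (2 * (1 + 3 * a)))
    identity = solve-∀
  go 3 _ e = contradiction e (1+3*≢3* (2 * φ m) m)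
  go k@(suc (suc (suc (suc _)))) _ e = begin
    8 * φ m            ≡⟨ *-assoc 4 2 (φ m) ⟩
    4 * (2 * φ m)      ≤⟨ *-monoˡ-≤ (2 * φ m) {4} {k} (s≤s (s≤s (s≤s (s≤s z≤n)))) ⟩
    k * (2 * φ m)      ≤⟨ n≤1+n _ ⟩
    suc (k * (2 * φ m)) ≡⟨ e ⟩
    3 * m              ∎
    where open ≤-Reasoning

-- Numbers prime to 2 and 3

2-prime : Prime 2
2-prime = from-yes (prime? 2)

odd⇒coprime-2^ : ∀ {n} → 2 ∤ n → ∀ α → Coprime n (2 ^ α)
odd⇒coprime-2^ 2∤n zero    = Coprimality.sym (Coprimality.1-coprimeTo _)
odd⇒coprime-2^ 2∤n (suc α) = coprime-* (prime∤⇒coprime 2-prime 2∤n) (odd⇒coprime-2^ 2∤n α)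

coprime-6⇒divisor≥5 : ∀ {n} .{{_ : NonZero n}} → 2 ∤ n → 3 ∤ n → ∀ {d} → d ∣ n → d ≢ 1 → 5 ≤ d
coprime-6⇒divisor≥5 {n} 2∤n 3∤n {0} 0∣n _ = contradiction (sym (0∣⇒≡0 0∣n)) (<⇒≢ (>-nonZero⁻¹ n))
coprime-6⇒divisor≥5 2∤n 3∤n {1} _ d≢1 = contradiction refl d≢1
coprime-6⇒divisor≥5 2∤n 3∤n {2} d∣n _ = contradiction d∣n 2∤n
coprime-6⇒divisor≥5 2∤n 3∤n {3} d∣n _ = contradiction d∣n 3∤n
coprime-6⇒divisor≥5 2∤n 3∤n {4} d∣n _ = contradiction (∣-trans (divides 2 refl) d∣n) 2∤n
coprime-6⇒divisor≥5 2∤n 3∤n {suc (suc (suc (suc (suc d))))} _ _ = m≤m+n 5 d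

-- A common divisor other than 1 would be at least 5 and at most 3. This makes the index of ⟨ x ⟩,
-- and the exponents that carry elements into ⟨ x ⟩, prime to `n`.
≤3⇒coprime : ∀ {n k} → (∀ {d} → d ∣ n → d ≢ 1 → 5 ≤ d) → 1 ≤ k → k ≤ 3 → Coprime n k
≤3⇒coprime divisor≥5 1≤k k≤3 {d} (d∣n , d∣k) with d ≟ 1
... | yes d≡1 = d≡1
... | no  d≢1 = contradiction (≤-trans (∣⇒≤ {{>-nonZero 1≤k}} d∣k) k≤3)
                  (<⇒≱ (<-≤-trans (n<1+n 3) (≤-trans (n≤1+n 4) (divisor≥5 d∣n d≢1))))

-- Orders of elements in a finite group

module Orders {N : ℕ} (G : FinGroup N) where

  open FinGroup G public using (_∙_; ε; _⁻¹; pow)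
  open FinGroup G using (isGroup; ordFrom)

  group : Group 0ℓ 0ℓ
  group = record { isGroup = isGroup }

  open Group group using (assoc; identityˡ; identityʳ; inverseˡ; inverseʳ) public
  open import Algebra.Properties.Group group using (∙-cancelˡ) public

  pow-+ : ∀ x a b → pow x (a + b) ≡ pow x a ∙ pow x b
  pow-+ x zero    b = sym (identityˡ _)
  pow-+ x (suc a) b = trans (cong (x ∙_) (pow-+ x a b)) (sym (assoc x _ _))

  pow-ε : ∀ k → pow ε k ≡ ε
  pow-ε zero    = refl
  pow-ε (suc k) = trans (identityˡ _) (pow-ε k)

  pow-* : ∀ x a b → pow x (a * b) ≡ pow (pow x a) b
  pow-* x a zero    = cong (pow x) (*-zeroʳ a)
  pow-* x a (suc b) = trans (cong (pow x) (*-suc a b))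
    (trans (pow-+ x a (a * b)) (cong (pow x a ∙_) (pow-* x a b)))

  pow-*-swap : ∀ x a b → pow (pow x a) b ≡ pow (pow x b) a
  pow-*-swap x a b = trans (sym (pow-* x a b)) (trans (cong (pow x) (*-comm a b)) (pow-* x b a))

  pow-∣ : ∀ {x a b} → a ∣ b → pow x a ≡ ε → pow x b ≡ ε
  pow-∣ {x} {a} (divides q refl) xᵃ≡ε =
    trans (cong (pow x) (*-comm q a)) (trans (pow-* x a q) (trans (cong (λ y → pow y q) xᵃ≡ε) (pow-ε q)))

  Commute : Fin N → Fin N → Set
  Commute x y = x ∙ y ≡ y ∙ x

  commute-∙ : ∀ {x y z} → Commute x z → Commute y z → Commute (x ∙ y) z
  commute-∙ {x} {y} {z} xz yz = begin
    (x ∙ y) ∙ z  ≡⟨ assoc x y z ⟩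
    x ∙ (y ∙ z)  ≡⟨ cong (x ∙_) yz ⟩
    x ∙ (z ∙ y)  ≡⟨ assoc x z y ⟨
    (x ∙ z) ∙ y  ≡⟨ cong (_∙ y) xz ⟩
    (z ∙ x) ∙ y  ≡⟨ assoc z x y ⟩
    z ∙ (x ∙ y)  ∎
    where open ≡-Reasoning

  commute-pow : ∀ {x y} k → Commute x y → Commute (pow x k) y
  commute-pow zero    xy = trans (identityˡ _) (sym (identityʳ _))
  commute-pow (suc k) xy = commute-∙ xy (commute-pow k xy)

  pow-∙ : ∀ {x y} k → Commute x y → pow (x ∙ y) k ≡ pow x k ∙ pow y k
  pow-∙         zero    xy = sym (identityˡ _)
  pow-∙ {x} {y} (suc k) xy = begin
    (x ∙ y) ∙ pow (x ∙ y) k         ≡⟨ cong ((x ∙ y) ∙_) (pow-∙ k xy) ⟩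
    (x ∙ y) ∙ (pow x k ∙ pow y k)   ≡⟨ assoc x y _ ⟩
    x ∙ (y ∙ (pow x k ∙ pow y k))   ≡⟨ cong (x ∙_) (assoc y _ _) ⟨
    x ∙ ((y ∙ pow x k) ∙ pow y k)   ≡⟨ cong (λ w → x ∙ (w ∙ pow y k)) (commute-pow k xy) ⟨
    x ∙ ((pow x k ∙ y) ∙ pow y k)   ≡⟨ cong (x ∙_) (assoc _ y _) ⟩
    x ∙ (pow x k ∙ (y ∙ pow y k))   ≡⟨ assoc x _ _ ⟨
    (x ∙ pow x k) ∙ (y ∙ pow y k)   ∎
    where open ≡-Reasoning

  pow-∸ : ∀ {x i j} → i ≤ j → pow x i ≡ pow x j → pow x (j ∸ i) ≡ ε
  pow-∸ {x} {i} {j} i≤j eq = ∙-cancelˡ (pow x i) _ _ (begin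
    pow x i ∙ pow x (j ∸ i)  ≡⟨ pow-+ x i (j ∸ i) ⟨
    pow x (i + (j ∸ i))      ≡⟨ cong (pow x) (m+[n∸m]≡n i≤j) ⟩
    pow x j                  ≡⟨ eq ⟨
    pow x i                  ≡⟨ identityʳ _ ⟨
    pow x i ∙ ε              ∎)
    where open ≡-Reasoning

  o : Fin N → ℕ
  o = ord G

  private
    -- A root exponent in the window from `k` to below `fuel + k` guarantees that the search stops
    -- at a tested value and does not return the default left when the fuel is spent.
    ordFrom-spec : ∀ x fuel k → (∃ λ l → k ≤ l × l < fuel + k × pow x l ≡ ε) →
                   k ≤ ordFrom x fuel k × pow x (ordFrom x fuel k) ≡ ε ×
                   (∀ {j} → k ≤ j → pow x j ≡ ε → ordFrom x fuel k ≤ j)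
    ordFrom-spec x zero       k (l , k≤l , l<k , _) = contradiction l<k (≤⇒≯ k≤l)
    ordFrom-spec x (suc fuel) k (l , k≤l , l<n , xˡ≡ε) with pow x k ≟ᶠ ε
    ... | yes xᵏ≡ε = ≤-refl , xᵏ≡ε , λ k≤j _ → k≤j
    ... | no  xᵏ≢ε =
      let sk≤r , xʳ≡ε , least = ordFrom-spec x fuel (suc k)
            (l , ≤∧≢⇒< k≤l (λ { refl → xᵏ≢ε xˡ≡ε }) , subst (l <_) (sym (+-suc fuel k)) l<n , xˡ≡ε)
      in <⇒≤ sk≤r , xʳ≡ε , λ k≤j xʲ≡ε → least (≤∧≢⇒< k≤j (λ { refl → xᵏ≢ε xʲ≡ε })) xʲ≡ε

    -- Among the N + 1 powers from `pow x 0` to `pow x N` two coincide; their difference is a root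
    -- exponent between 1 and `N`, inside the window of the search.
    ord-spec : ∀ x → 1 ≤ o x × pow x (o x) ≡ ε × (∀ {j} → 1 ≤ j → pow x j ≡ ε → o x ≤ j)
    ord-spec x with i , j , i<j , eq ← Fin.pigeonhole (n<1+n N) (λ (i : Fin (suc N)) → pow x (toℕ i)) =
      ordFrom-spec x N 1 (toℕ j ∸ toℕ i , m<n⇒0<n∸m i<j ,
        subst (toℕ j ∸ toℕ i <_) (+-comm 1 N) (≤-<-trans (m∸n≤m (toℕ j) (toℕ i)) (Fin.toℕ<n j)) ,
        pow-∸ (<⇒≤ i<j) eq)

  ord≥1 : ∀ x → 1 ≤ o x
  ord≥1 x = proj₁ (ord-spec x)

  instance
    ord-nonZero : ∀ {x} → NonZero (o x)
    ord-nonZero {x} = >-nonZero (ord≥1 x)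

  pow-ord : ∀ x → pow x (o x) ≡ ε
  pow-ord x = proj₁ (proj₂ (ord-spec x))

  ord-least : ∀ x {j} → 1 ≤ j → pow x j ≡ ε → o x ≤ j
  ord-least x = proj₂ (proj₂ (ord-spec x))

  pow-% : ∀ x k → pow x k ≡ pow x (k % o x)
  pow-% x k = begin
    pow x k                                  ≡⟨ cong (pow x) (m≡m%n+[m/n]*n k (o x)) ⟩
    pow x (k % o x + k ÷ o x * o x)          ≡⟨ pow-+ x (k % o x) _ ⟩
    pow x (k % o x) ∙ pow x (k ÷ o x * o x)  ≡⟨ cong (pow x (k % o x) ∙_) (pow-∣ (n∣m*n (k ÷ o x)) (pow-ord x)) ⟩
    pow x (k % o x) ∙ ε                      ≡⟨ identityʳ _ ⟩
    pow x (k % o x)                          ∎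
    where open ≡-Reasoning

  ord-∣ : ∀ x {k} → pow x k ≡ ε → o x ∣ k
  ord-∣ x {k} xᵏ≡ε = m%n≡0⇒n∣m k (o x) (go (k % o x) (m%n<n k (o x)) (trans (sym (pow-% x k)) xᵏ≡ε))
    where
    go : ∀ r → r < o x → pow x r ≡ ε → r ≡ 0
    go zero    _   _ = refl
    go (suc r) r<o e = contradiction (ord-least x (s≤s z≤n) e) (<⇒≱ r<o)

  pow-injective : ∀ x {i j} → i < o x → j < o x → pow x i ≡ pow x j → i ≡ j
  pow-injective x {i} {j} i<o j<o eq with <-cmp i j
  ... | tri≈ _ i≡j _ = i≡j
  ... | tri< i<j _ _ = contradiction (ord-least x (m<n⇒0<n∸m i<j) (pow-∸ (<⇒≤ i<j) eq))
                         (<⇒≱ (≤-<-trans (m∸n≤m j i) j<o))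
  ... | tri> _ _ j<i = contradiction (ord-least x (m<n⇒0<n∸m j<i) (pow-∸ (<⇒≤ j<i) (sym eq)))
                         (<⇒≱ (≤-<-trans (m∸n≤m i j) i<o))

  -- Multiplying by `pow x (o x ∸ i)` cancels `pow x i`, so the quotient stays a power of `x` with a
  -- natural exponent.
  same-coset : ∀ {x y w i j} → i ≤ o x → y ∙ pow x i ≡ w ∙ pow x j → y ≡ w ∙ pow x (j + (o x ∸ i))
  same-coset {x} {y} {w} {i} {j} i≤o eq = begin
    y                                     ≡⟨ identityʳ y ⟨
    y ∙ ε                                 ≡⟨ cong (y ∙_) (pow-ord x) ⟨
    y ∙ pow x (o x)                       ≡⟨ cong (λ l → y ∙ pow x l) (m+[n∸m]≡n i≤o) ⟨
    y ∙ pow x (i + (o x ∸ i))             ≡⟨ cong (y ∙_) (pow-+ x i _) ⟩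
    y ∙ (pow x i ∙ pow x (o x ∸ i))       ≡⟨ assoc y _ _ ⟨
    (y ∙ pow x i) ∙ pow x (o x ∸ i)       ≡⟨ cong (_∙ pow x (o x ∸ i)) eq ⟩
    (w ∙ pow x j) ∙ pow x (o x ∸ i)       ≡⟨ assoc w _ _ ⟩
    w ∙ (pow x j ∙ pow x (o x ∸ i))       ≡⟨ cong (w ∙_) (pow-+ x j _) ⟨
    w ∙ pow x (j + (o x ∸ i))             ∎
    where open ≡-Reasoning

  -- Choose representatives of cosets of ⟨ x ⟩ greedily until the cosets cover the group.
  lagrange : ∀ x → o x ∣ N
  lagrange x = extend N 0 (λ ()) (λ ()) (m≤m+n N 0)
    where
    M = o x
    Separated : ∀ {k} → (Fin k → Fin N) → Set
    Separated r = ∀ a b i j → i < M → j < M → r a ∙ pow x i ≡ r b ∙ pow x j → a ≡ b × i ≡ j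

    module Cosets {k} (r : Fin k → Fin N) (sep : Separated r) where
      element : Fin (k * M) → Fin N
      element c = r (proj₁ (remQuot {k} M c)) ∙ pow x (toℕ (proj₂ (remQuot {k} M c)))

      element-injective : Injective _≡_ _≡_ element
      element-injective {c} {d} eq
        with a≡b , i≡j ← sep _ _ _ _ (Fin.toℕ<n (proj₂ (remQuot {k} M c))) (Fin.toℕ<n (proj₂ (remQuot {k} M d))) eq =
        trans (sym (Fin.combine-remQuot {k} M c))
          (trans (cong₂ combine a≡b (Fin.toℕ-injective i≡j)) (Fin.combine-remQuot {k} M d))

      card : k * M ≤ N
      card = Fin.injective⇒≤ element-injective

    extend : ∀ fuel k (r : Fin k → Fin N) → Separated r → N ≤ fuel + k → M ∣ N
    extend fuel k r sep N≤ with Fin.all? (λ y → Fin.any? (λ c → Cosets.element r sep c ≟ᶠ y))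
    ... | yes covers = divides k (≤-antisym (Fin.injective⇒≤ λ {y} {w} eq →
            trans (sym (proj₂ (covers y))) (trans (cong element eq) (proj₂ (covers w)))) card)
      where open Cosets r sep
    ... | no ¬covers with y , missed ← Fin.¬∀⟶∃¬ N _ (λ y → Fin.any? (λ c → Cosets.element r sep c ≟ᶠ y)) ¬covers = next fuel N≤
      where
      open Cosets r sep
      r′ : Fin (suc k) → Fin N
      r′ zero    = y
      r′ (suc a) = r a
      new : ∀ a i j → i < M → y ∙ pow x i ≢ r a ∙ pow x j
      new a i j i<M eq = missed (combine a l , trans (cong (λ (b , m) → r b ∙ pow x (toℕ m)) (Fin.remQuot-combine a l))
        (sym (trans (same-coset {j = j} (<⇒≤ i<M) eq) (cong (r a ∙_) (trans (pow-% x (j + (M ∸ i))) (cong (pow x) (sym (Fin.toℕ-fromℕ< (m%n<n (j + (M ∸ i)) M)))))))))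
        where
        l : Fin M
        l = fromℕ< (m%n<n (j + (M ∸ i)) M)
      sep′ : Separated r′
      sep′ zero    zero    i j i<M j<M eq = refl , pow-injective x i<M j<M (∙-cancelˡ y _ _ eq)
      sep′ zero    (suc b) i j i<M j<M eq = contradiction eq (new b i j i<M)
      sep′ (suc a) zero    i j i<M j<M eq = contradiction (sym eq) (new a j i j<M)
      sep′ (suc a) (suc b) i j i<M j<M eq with refl , i≡j ← sep a b i j i<M j<M eq = refl , i≡j
      next : ∀ fuel → N ≤ fuel + k → M ∣ N
      -- When the fuel is spent there are at least `N` representatives already, and one more would
      -- give more than `N` elements.
      next zero       N≤k = contradiction N≤k (<⇒≱ (≤-trans (m≤m*n (suc k) M) (Cosets.card r′ sep′)))
      next (suc fuel) N≤  = extend fuel (suc k) r′ sep′ (subst (N ≤_) (sym (+-suc fuel k)) N≤)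

  -- Pigeonhole on the products `pow y a ∙ pow x j` with `a ≤ k` and `j < o x`. A collision with
  -- equal `a` would force equal `j`, so the exponents of `y` differ, and their difference is the
  -- required `i`. As ⟨ `x` ⟩ may fail to be normal, `i` depends on `y`.
  power-in-cyclic : ∀ x y k → N < suc k * o x → ∃ λ i → 1 ≤ i × i ≤ k × ∃ λ s → pow y i ≡ pow x s
  power-in-cyclic x y k N< = collision (Fin.pigeonhole N< element)
    where
    q : Fin (suc k * o x) → Fin (suc k) × Fin (o x)
    q = remQuot {suc k} (o x)
    element : Fin (suc k * o x) → Fin N
    element c = pow y (toℕ (proj₁ (q c))) ∙ pow x (toℕ (proj₂ (q c)))
    ordered : ∀ (a b : Fin (suc k)) (i j : Fin (o x)) → toℕ a < toℕ b →
              pow y (toℕ a) ∙ pow x (toℕ i) ≡ pow y (toℕ b) ∙ pow x (toℕ j) →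
              ∃ λ i → 1 ≤ i × i ≤ k × ∃ λ s → pow y i ≡ pow x s
    ordered a b i j a<b eq =
      toℕ b ∸ toℕ a , m<n⇒0<n∸m a<b , ≤-trans (m∸n≤m (toℕ b) (toℕ a)) (s≤s⁻¹ (Fin.toℕ<n b)) ,
      toℕ i + (o x ∸ toℕ j) ,
      trans (same-coset {w = ε} {j = toℕ i} (<⇒≤ (Fin.toℕ<n j)) (∙-cancelˡ (pow y (toℕ a)) _ _ (begin
        pow y (toℕ a) ∙ (pow y (toℕ b ∸ toℕ a) ∙ pow x (toℕ j)) ≡⟨ assoc _ _ _ ⟨
        (pow y (toℕ a) ∙ pow y (toℕ b ∸ toℕ a)) ∙ pow x (toℕ j) ≡⟨ cong (_∙ pow x (toℕ j)) (pow-+ y (toℕ a) _) ⟨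
        pow y (toℕ a + (toℕ b ∸ toℕ a)) ∙ pow x (toℕ j)         ≡⟨ cong (λ l → pow y l ∙ pow x (toℕ j)) (m+[n∸m]≡n (<⇒≤ a<b)) ⟩
        pow y (toℕ b) ∙ pow x (toℕ j)                           ≡⟨ eq ⟨
        pow y (toℕ a) ∙ pow x (toℕ i)                           ≡⟨ cong (pow y (toℕ a) ∙_) (identityˡ _) ⟨
        pow y (toℕ a) ∙ (ε ∙ pow x (toℕ i))                     ∎))) (identityˡ _)
      where open ≡-Reasoning
    collision : (∃₂ λ c d → toℕ c < toℕ d × element c ≡ element d) →
                ∃ λ i → 1 ≤ i × i ≤ k × ∃ λ s → pow y i ≡ pow x s
    collision (c , d , c<d , eq) with Fin.<-cmp (proj₁ (q c)) (proj₁ (q d))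
    ... | tri< a<b _ _ = ordered (proj₁ (q c)) (proj₁ (q d)) (proj₂ (q c)) (proj₂ (q d)) a<b eq
    ... | tri> _ _ b<a = ordered (proj₁ (q d)) (proj₁ (q c)) (proj₂ (q d)) (proj₂ (q c)) b<a (sym eq)
    ... | tri≈ _ a≡b _ = contradiction (begin
      c                                        ≡⟨ Fin.combine-remQuot {suc k} (o x) c ⟨
      combine (proj₁ (q c)) (proj₂ (q c))      ≡⟨ cong₂ combine a≡b i≡j ⟩
      combine (proj₁ (q d)) (proj₂ (q d))      ≡⟨ Fin.combine-remQuot {suc k} (o x) d ⟩
      d                                        ∎) (Fin.<⇒≢ c<d)
      where
      open ≡-Reasoning
      i≡j : proj₂ (q c) ≡ proj₂ (q d)
      i≡j = Fin.toℕ-injective (pow-injective x (Fin.toℕ<n (proj₂ (q c))) (Fin.toℕ<n (proj₂ (q d)))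
        (∙-cancelˡ (pow y (toℕ (proj₁ (q c)))) _ _
          (trans eq (cong (λ a → pow y (toℕ a) ∙ pow x (toℕ (proj₂ (q d)))) (sym a≡b)))))

  -- If `2 * o x` exceeded `N`, the pigeonhole with `k = 1` would put every `y` itself into ⟨ `x` ⟩.
  noncyclic⇒2ord≤N : ¬ Cyclic G → ∀ x → 2 * o x ≤ N
  noncyclic⇒2ord≤N ¬cyclic x with 2 * o x ≤? N
  ... | yes 2o≤N = 2o≤N
  ... | no  2o≰N = contradiction (x , generates) ¬cyclic
    where
    generates : ∀ y → ∃ λ k → pow x k ≡ y
    generates y with power-in-cyclic x y 1 (≰⇒> 2o≰N)
    ... | i , 1≤i , i≤1 , s , yⁱ≡xˢ with refl ← ≤-antisym i≤1 1≤i = s , trans (sym yⁱ≡xˢ) (identityʳ y)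

  ∙-permutation : Fin N → Permutation N N
  ∙-permutation g = permutation (_∙ g) (_∙ (g ⁻¹))
    (λ y → trans (assoc y _ _) (trans (cong (y ∙_) (inverseˡ g)) (identityʳ y)))
    (λ y → trans (assoc y _ _) (trans (cong (y ∙_) (inverseʳ g)) (identityʳ y)))

-- Averaging over the cosets of ⟨ z ⟩

-- `k` is the index of ⟨ `x` ⟩ and `n` stands for n′; that n′ is prime to 6 enters only as
-- `divisor≥5`.
module Averaging {N : ℕ} (G : FinGroup N) (¬cyclic : ¬ Cyclic G)
  (x : Fin N) (k m n : ℕ)
  (o[x] : ord G x ≡ m * n) (card : k * (m * n) ≡ N) (k≤3 : k ≤ 3) (1<n : 1 < n)
  (m⊥n : Coprime m n) (divisor≥5 : ∀ {d} → d ∣ n → d ≢ 1 → 5 ≤ d) where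

  open Orders G

  private instance
    mn≢0 : NonZero (m * n)
    mn≢0 = subst NonZero o[x] (ord-nonZero {x})
    m≢0 : NonZero m
    m≢0 = m*n≢0⇒m≢0 m
    n≢0 : NonZero n
    n≢0 = m*n≢0⇒n≢0 m

  z : Fin N
  z = pow x m

  z^n : pow z n ≡ ε
  z^n = trans (sym (pow-* x m n)) (trans (cong (pow x) (sym o[x])) (pow-ord x))

  pow-z-∣ : ∀ {l} → pow z l ≡ ε → n ∣ l
  pow-z-∣ {l} zˡ≡ε = *-cancelˡ-∣ m (subst (_∣ m * l) o[x] (ord-∣ x (trans (pow-* x m l) zˡ≡ε)))

  pow-z-mod : ∀ a b → pow z (a + b * n) ≡ pow z a
  pow-z-mod a b = trans (pow-+ z a (b * n)) (trans (cong (pow z a ∙_) (pow-∣ (n∣m*n b) z^n)) (identityʳ _))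

  power-in-⟨x⟩ : ∀ y → ∃ λ i → 1 ≤ i × i ≤ k × ∃ λ s → pow y i ≡ pow x s
  power-in-⟨x⟩ y = power-in-cyclic x y k (subst (λ l → N < suc k * l) (sym o[x])
    (subst (_< suc k * (m * n)) card (m<n+m (k * (m * n)) (>-nonZero⁻¹ (m * n)))))

  S : Fin N → ℕ
  S y = ∑< n (λ j → o (y ∙ pow z j))

  -- Right multiplication by each `pow z j` permutes the group. Summing over all `y` counts every
  -- coset `n` times, so no representatives have to be chosen.
  average : n * ψ G ≡ ∑[ y < N ] S y
  average = begin
    n * ψ G                                        ≡⟨ cong (n *_) (∑-list o) ⟩
    n * sum o                                      ≡⟨ ∑-const n ⟨
    ∑< n (λ _ → sum o)                             ≡⟨ ∑<-cong n (λ j → sum-permute o (∙-permutation (pow z j))) ⟩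
    ∑< n (λ j → ∑[ y < N ] o (y ∙ pow z j))        ≡⟨ ∑-comm {n} (λ j y → o (y ∙ pow z (toℕ j))) ⟩
    ∑[ y < N ] S y                                 ∎
    where open ≡-Reasoning

  S-shift : ∀ y t → S (y ∙ pow z t) ≡ S y
  S-shift y t = trans
    (∑<-cong n λ j → cong o (trans (assoc y _ _) (cong (y ∙_) (sym (pow-+ z t j)))))
    (∑<-shift n t {λ j → o (y ∙ pow z j)} λ j → cong (λ w → o (y ∙ w))
      (trans (cong (pow z) (trans (+-comm n j) (cong (λ s → j + s) (sym (*-identityˡ n))))) (pow-z-mod j 1)))

  -- Let `pow y i ≡ pow x s` and let `w` invert `i * m` modulo `n`, so that F = i * m * w is 1
  -- modulo `n`. Then y ^ F = z ^ (s * w), while raising to F fixes every power of `z`; multiplying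
  -- `y` by a suitable power of `z` corrects the exponent to 1.
  z-as-power : ∀ {y} → Commute y z → ∃ λ t → ∃ λ q → pow (y ∙ pow z t) (1 + q * n) ≡ z
  z-as-power {y} yz
    with i , 1≤i , i≤k , s , yⁱ≡xˢ ← power-in-⟨x⟩ y
    with w , q , imw≡ ← coprime-inverse 1<n
           (Coprimality.sym (coprime-* (≤3⇒coprime divisor≥5 1≤i (≤-trans i≤k k≤3)) (Coprimality.sym m⊥n)))
    = t , q , (begin
      pow (y ∙ pow z t) (1 + q * n)              ≡⟨ pow-∙ (1 + q * n) (sym (commute-pow t (sym yz))) ⟩
      pow y (1 + q * n) ∙ pow (pow z t) (1 + q * n)
        ≡⟨ cong₂ _∙_ y^F (trans (sym (pow-* z t (1 + q * n)))
                           (trans (cong (pow z) (identity₁ t q n)) (pow-z-mod t (t * q)))) ⟩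
      pow z (s * w) ∙ pow z t                    ≡⟨ pow-+ z (s * w) t ⟨
      pow z (s * w + t)                          ≡⟨ cong (pow z) s*w+t ⟩
      pow z (1 + s * w * n)                      ≡⟨ pow-z-mod 1 (s * w) ⟩
      pow z 1                                    ≡⟨ identityʳ z ⟩
      z                                          ∎)
    where
    open ≡-Reasoning
    -- A natural number congruent to 1 - s * w modulo `n`, with `pred n` in the role of -1.
    t : ℕ
    t = 1 + pred n * (s * w)
    identity₁ : ∀ t q n → t * (1 + q * n) ≡ t + t * q * n
    identity₁ = solve-∀
    identity₂ : ∀ a l → a + (1 + l * a) ≡ 1 + a * suc l
    identity₂ = solve-∀
    s*w+t : s * w + t ≡ 1 + s * w * n
    s*w+t = trans (identity₂ (s * w) (pred n)) (cong (λ l → 1 + s * w * l) (suc-pred n))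
    y^F : pow y (1 + q * n) ≡ pow z (s * w)
    y^F = begin
      pow y (1 + q * n)              ≡⟨ cong (pow y) imw≡ ⟨
      pow y (i * m * w)              ≡⟨ pow-* y (i * m) w ⟩
      pow (pow y (i * m)) w          ≡⟨ cong (λ v → pow v w) (pow-* y i m) ⟩
      pow (pow (pow y i) m) w        ≡⟨ cong (λ v → pow (pow v m) w) yⁱ≡xˢ ⟩
      pow (pow (pow x s) m) w        ≡⟨ cong (λ v → pow v w) (pow-*-swap x s m) ⟩
      pow (pow z s) w                ≡⟨ pow-* z s w ⟨
      pow z (s * w)                  ∎

  -- Five times φ(n) + (n - φ(n)) / 5: weight 1 for the exponents prime to `n` and at most 1/5 for
  -- the others.
  κ : ℕ
  κ = 4 * φ n + n

  -- With F = 1 + q * n, the coset consists of the `pow u (1 + F * j)`. A common divisor d of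
  -- `suc j` and `n` divides 1 + F * j = suc j + j * q * n, and it divides `l` because
  -- `pow z l ≡ ε`. So the j-th element is killed by l / d, and d ≥ 5 unless `suc j` is prime to
  -- `n`. Leaving `l` free covers both the order of `u` and a prescribed root exponent.
  coset-orders : ∀ {u q l} → pow u (1 + q * n) ≡ z → pow u l ≡ ε → 1 ≤ l → 5 * S u ≤ κ * l
  coset-orders {u} {q} {l} u^F uˡ≡ε 1≤l = begin
    5 * S u                                     ≡⟨ ∑-scale {n} 5 (λ j → o (u ∙ pow z (toℕ j))) ⟩
    ∑< n (λ j → 5 * o (u ∙ pow z j))            ≤⟨ ∑-mono {n} (pointwise ∘ toℕ) ⟩
    ∑< n (λ j → l * (4 * χ n (suc j) + 1))      ≡⟨ ∑-scale {n} l (λ j → 4 * χ n (suc (toℕ j)) + 1) ⟨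
    l * ∑< n (λ j → 4 * χ n (suc j) + 1)        ≡⟨ cong (l *_) total ⟩
    l * κ                                       ≡⟨ *-comm l κ ⟩
    κ * l                                       ∎
    where
    open ≤-Reasoning
    F : ℕ
    F = 1 + q * n
    total : ∑< n (λ j → 4 * χ n (suc j) + 1) ≡ κ
    total = trans (∑-distrib-+ {n} (λ j → 4 * χ n (suc (toℕ j))) (λ _ → 1)) (cong₂ _+_
      (trans (sym (∑-scale {n} 4 (λ j → χ n (suc (toℕ j))))) (cong (4 *_) (sym (φ-∑ n))))
      (trans (∑-const n) (*-identityʳ n)))
    as-power : ∀ j → pow u (1 + F * j) ≡ u ∙ pow z j
    as-power j = cong (u ∙_) (trans (pow-* u F j) (cong (λ v → pow v j) u^F))
    n∣l : n ∣ l
    n∣l = pow-z-∣ (trans (cong (λ v → pow v l) (sym u^F))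
            (trans (sym (pow-* u F l)) (pow-∣ {u} {l} (n∣m*n F) uˡ≡ε)))
    bound : ∀ j {d} → d ∣ 1 + F * j → (d∣l : d ∣ l) → d * o (u ∙ pow z j) ≤ l
    bound j {d} d∣F (divides e l≡) = begin
      d * o (u ∙ pow z j)  ≤⟨ *-monoʳ-≤ d (ord-least (u ∙ pow z j) 1≤e w^e) ⟩
      d * e                ≡⟨ *-comm d e ⟩
      e * d                ≡⟨ l≡ ⟨
      l                    ∎
      where
      1≤e : 1 ≤ e
      1≤e = n≢0⇒n>0 λ e≡0 → contradiction (subst (1 ≤_) (trans l≡ (cong (_* d) e≡0)) 1≤l) λ ()
      w^e : pow (u ∙ pow z j) e ≡ ε
      w^e = trans (cong (λ v → pow v e) (sym (as-power j))) (trans (sym (pow-* u (1 + F * j) e))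
              (pow-∣ {u} {l} (subst (_∣ (1 + F * j) * e) (sym (trans l≡ (*-comm e d))) (*-monoˡ-∣ e d∣F)) uˡ≡ε))
    identity : ∀ j q n → suc j + j * q * n ≡ 1 + (1 + q * n) * j
    identity = solve-∀
    pointwise : ∀ j → 5 * o (u ∙ pow z j) ≤ l * (4 * χ n (suc j) + 1)
    pointwise j with χ-cases n (suc j)
    ... | inj₁ χ≡1 rewrite χ≡1 = begin
      5 * o (u ∙ pow z j)        ≤⟨ *-monoʳ-≤ 5 (subst (_≤ l) (*-identityˡ _) (bound j (1∣ _) (1∣ l))) ⟩
      5 * l                      ≡⟨ *-comm 5 l ⟩
      l * 5                      ∎
    ... | inj₂ (χ≡0 , d≢1) rewrite χ≡0 = begin
      5 * o (u ∙ pow z j)                ≤⟨ *-monoˡ-≤ _ (divisor≥5 d∣n d≢1) ⟩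
      gcd (suc j) n * o (u ∙ pow z j)    ≤⟨ bound j d∣F (∣-trans d∣n n∣l) ⟩
      l                                  ≡⟨ *-identityʳ l ⟨
      l * 1                              ∎
      where
      d∣n = gcd[m,n]∣n (suc j) n
      d∣F : gcd (suc j) n ∣ 1 + F * j
      d∣F = subst (gcd (suc j) n ∣_) (identity j q n)
              (∣m∣n⇒∣m+n (gcd[m,n]∣m (suc j) n) (∣n⇒∣m*n (j * q) d∣n))

  commuting-S≤ : ∀ {y} → Commute y z → ∃ λ l → 2 * l ≤ N × 5 * S y ≤ κ * l
  commuting-S≤ {y} yz =
    let t , q , u^F = z-as-power yz
        u = y ∙ pow z t
    in o u , noncyclic⇒2ord≤N ¬cyclic u ,
       subst (λ s → 5 * s ≤ κ * o u) (S-shift y t) (coset-orders {u} {q} u^F (pow-ord u) (ord≥1 u))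

  -- Passing from `y` to the element `y ∙ pow z t` that has `z` among its powers keeps it killed by
  -- `l`, since `n ∣ l`.
  commuting-root-S≤ : ∀ {y l} → Commute y z → n ∣ l → 1 ≤ l → pow y l ≡ ε → 5 * S y ≤ κ * l
  commuting-root-S≤ {y} {l} yz n∣l 1≤l yˡ≡ε =
    let t , q , u^F = z-as-power yz
        uˡ≡ε = trans (pow-∙ l (sym (commute-pow t (sym yz)))) (trans
          (cong₂ _∙_ yˡ≡ε (trans (sym (pow-* z t l)) (pow-∣ {z} {n} (∣n⇒∣m*n t n∣l) z^n))) (identityʳ ε))
    in subst (λ s → 5 * s ≤ κ * l) (S-shift y t) (coset-orders {y ∙ pow z t} {q} u^F uˡ≡ε 1≤l)

  -- If y ^ i = x ^ s with s prime to n, then z is a power of y ^ i and commutes with y.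
  noncommuting-ord≤ : ∀ {y} → ¬ Commute y z → 5 * o y ≤ N
  noncommuting-ord≤ {y} ¬yz =
    let i , 1≤i , i≤k , s , yⁱ≡xˢ = power-in-⟨x⟩ y
    in case i s 1≤i i≤k yⁱ≡xˢ (gcd s n) refl
    where
    coprime-case : ∀ i s → pow y i ≡ pow x s → Coprime s n → Commute y z
    coprime-case i s yⁱ≡xˢ s⊥n =
      let w , q , sw≡ = coprime-inverse 1<n s⊥n
      in sym (subst (λ v → Commute v y) (z≡ w q sw≡) (commute-pow w (commute-pow m (commute-pow i refl))))
      where
      open ≡-Reasoning
      z≡ : ∀ w q → s * w ≡ 1 + q * n → pow (pow (pow y i) m) w ≡ z
      z≡ w q sw≡ = begin
        pow (pow (pow y i) m) w  ≡⟨ cong (λ v → pow (pow v m) w) yⁱ≡xˢ ⟩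
        pow (pow (pow x s) m) w  ≡⟨ cong (λ v → pow v w) (pow-*-swap x s m) ⟩
        pow (pow z s) w          ≡⟨ pow-* z s w ⟨
        pow z (s * w)            ≡⟨ cong (pow z) sw≡ ⟩
        pow z (1 + q * n)        ≡⟨ pow-z-mod 1 q ⟩
        pow z 1                  ≡⟨ identityʳ z ⟩
        z                        ∎
    -- With d = gcd(s, n) ≥ 5, the exponent i * m * (n / d) kills `y`, because it turns x ^ s into a
    -- power of x ^ (m * n). It is at most k * m * n / d = N / d.
    divisor-case : ∀ i s d c → 1 ≤ i → i ≤ k → pow y i ≡ pow x s → d ∣ s → n ≡ c * d → 5 ≤ d → 5 * o y ≤ N
    divisor-case i s d c 1≤i i≤k yⁱ≡xˢ d∣s n≡ 5≤d = begin
      5 * o y                ≤⟨ *-monoʳ-≤ 5 (ord-least y 1≤imc y^imc) ⟩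
      5 * (i * (m * c))      ≤⟨ *-mono-≤ 5≤d (*-monoˡ-≤ (m * c) i≤k) ⟩
      d * (k * (m * c))      ≡⟨ identity₁ d k m c ⟩
      k * (m * (c * d))      ≡⟨ cong (λ l → k * (m * l)) n≡ ⟨
      k * (m * n)            ≡⟨ card ⟩
      N                      ∎
      where
      open ≤-Reasoning
      identity₁ : ∀ d k m c → d * (k * (m * c)) ≡ k * (m * (c * d))
      identity₁ = solve-∀
      identity₂ : ∀ d m c → m * (c * d) ≡ d * (m * c)
      identity₂ = solve-∀
      c≢0 : NonZero c
      c≢0 = m*n≢0⇒m≢0 c {{subst NonZero n≡ n≢0}}
      1≤imc : 1 ≤ i * (m * c)
      1≤imc = *-mono-≤ 1≤i (*-mono-≤ (>-nonZero⁻¹ m) (>-nonZero⁻¹ c {{c≢0}}))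
      o∣smc : o x ∣ s * (m * c)
      o∣smc = subst (_∣ s * (m * c)) (sym (trans o[x] (trans (cong (m *_) n≡) (identity₂ d m c))))
                (*-monoˡ-∣ (m * c) d∣s)
      y^imc : pow y (i * (m * c)) ≡ ε
      y^imc = trans (pow-* y i (m * c)) (trans (cong (λ v → pow v (m * c)) yⁱ≡xˢ)
        (trans (sym (pow-* x s (m * c))) (pow-∣ {x} {o x} o∣smc (pow-ord x))))
    case : ∀ i s → 1 ≤ i → i ≤ k → pow y i ≡ pow x s → ∀ d → gcd s n ≡ d → 5 * o y ≤ N
    case i s 1≤i i≤k yⁱ≡xˢ d gcd≡d with d ≟ 1 | subst (_∣ n) gcd≡d (gcd[m,n]∣n s n)
    ... | yes refl | _ = contradiction (coprime-case i s yⁱ≡xˢ (gcd≡1⇒coprime gcd≡d)) ¬yz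
    ... | no  d≢1  | d∣n@(divides c n≡) = divisor-case i s d c 1≤i i≤k yⁱ≡xˢ
                       (subst (_∣ s) gcd≡d (gcd[m,n]∣m s n)) n≡ (divisor≥5 d∣n d≢1)

  noncommuting-S≤ : ∀ {y} → ¬ Commute y z → 5 * S y ≤ n * N
  noncommuting-S≤ {y} ¬yz = begin
    5 * S y                            ≡⟨ ∑-scale {n} 5 (λ j → o (y ∙ pow z (toℕ j))) ⟩
    ∑< n (λ j → 5 * o (y ∙ pow z j))   ≤⟨ ∑-≤-const {n} (λ j → noncommuting-ord≤ (¬yz ∘ strip (toℕ j))) ⟩
    n * N                              ∎
    where
    open ≤-Reasoning
    strip : ∀ j → Commute (y ∙ pow z j) z → Commute y z
    -- `pow z (j * pred n)` is the inverse of `pow z j`.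
    strip j c = subst (λ v → Commute v z)
      (trans (assoc y _ _) (trans (cong (y ∙_) (trans (sym (pow-+ z j (j * pred n)))
        (trans (cong (pow z) (trans (sym (*-suc j (pred n))) (cong (j *_) (suc-pred n)))) (pow-∣ {z} {n} (n∣m*n j) z^n))))
        (identityʳ y)))
      (commute-∙ c (commute-pow (j * pred n) refl))

-- Bounds for ψ in the presence of a cyclic subgroup of small index

module Bounds {N : ℕ} (G : FinGroup N) (¬cyclic : ¬ Cyclic G)
  (x : Fin N) (k m n : ℕ)
  (o[x] : ord G x ≡ m * n) (card : k * (m * n) ≡ N) (k≤3 : k ≤ 3) (1<n : 1 < n)
  (m⊥n : Coprime m n) (divisor≥5 : ∀ {d} → d ∣ n → d ≢ 1 → 5 ≤ d) where

  open Orders G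
  open Averaging G ¬cyclic x k m n o[x] card k≤3 1<n m⊥n divisor≥5

  private
    n≢0 : NonZero n
    n≢0 = >-nonZero (<⇒≤ 1<n)

  commute? : ∀ y → Dec (Commute y z)
  commute? y = y ∙ z ≟ᶠ z ∙ y

  scaled-average : ∀ c → n * (c * ψ G) ≡ ∑[ y < N ] (c * S y)
  scaled-average c = trans (identity n c (ψ G)) (trans (cong (c *_) average) (∑-scale c S))
    where
    identity : ∀ n c p → n * (c * p) ≡ c * (n * p)
    identity = solve-∀

  -- The scale 20 is a common denominator of 3/10, 1/4 and 1/5: `r` will be 6 or 5, against 4 for
  -- elements that do not commute with `z`.
  commuting-20S≤ : ∀ {r y} → 2 * κ ≤ r * n → Commute y z → 20 * S y ≤ r * (n * N)
  commuting-20S≤ {r} {y} 2κ≤ yz = let l , 2l≤N , 5S≤ = commuting-S≤ yz in begin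
    20 * S y           ≡⟨ *-assoc 4 5 (S y) ⟩
    4 * (5 * S y)      ≤⟨ *-monoʳ-≤ 4 5S≤ ⟩
    4 * (κ * l)        ≡⟨ identity κ l ⟩
    2 * κ * (2 * l)    ≤⟨ *-mono-≤ 2κ≤ 2l≤N ⟩
    r * n * N          ≡⟨ *-assoc r n N ⟩
    r * (n * N)        ∎
    where
    open ≤-Reasoning
    identity : ∀ κ l → 4 * (κ * l) ≡ 2 * κ * (2 * l)
    identity = solve-∀

  noncommuting-20S≤ : ∀ {y} → ¬ Commute y z → 20 * S y ≤ 4 * (n * N)
  noncommuting-20S≤ {y} ¬yz = subst (_≤ 4 * (n * N)) (sym (*-assoc 4 5 (S y)))
    (*-monoʳ-≤ 4 (noncommuting-S≤ ¬yz))

  20S≤ : ∀ {r} → 4 ≤ r → 2 * κ ≤ r * n → ∀ y → 20 * S y ≤ r * (n * N)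
  20S≤ {r} 4≤r 2κ≤ y = split (commute? y)
    where
    split : Dec (Commute y z) → 20 * S y ≤ r * (n * N)
    split (yes yz) = commuting-20S≤ {r} 2κ≤ yz
    split (no ¬yz) = ≤-trans (noncommuting-20S≤ ¬yz) (*-monoˡ-≤ (n * N) 4≤r)

  20ψ≤ : ∀ {r} → 4 ≤ r → 2 * κ ≤ r * n → 20 * ψ G ≤ r * (N * N)
  20ψ≤ {r} 4≤r 2κ≤ = *-cancelˡ-≤ n {{n≢0}} (begin
    n * (20 * ψ G)            ≡⟨ scaled-average 20 ⟩
    ∑[ y < N ] (20 * S y)     ≤⟨ ∑-≤-const (20S≤ 4≤r 2κ≤) ⟩
    N * (r * (n * N))         ≡⟨ identity N r n ⟩
    n * (r * (N * N))         ∎)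
    where
    open ≤-Reasoning
    identity : ∀ N r n → N * (r * (n * N)) ≡ n * (r * (N * N))
    identity = solve-∀

  -- Of y and y ∙ g at most one commutes with z.
  noncentral-4ψ≤ : ∀ {g} → ¬ Commute g z → 2 * κ ≤ 6 * n → 4 * ψ G ≤ N * N
  noncentral-4ψ≤ {g} ¬gz 2κ≤ = *-cancelˡ-≤ 10 (*-cancelˡ-≤ n {{n≢0}} (begin
    n * (10 * (4 * ψ G))                                       ≡⟨ identity₁ n (ψ G) ⟩
    n * (20 * ψ G) + n * (20 * ψ G)                            ≡⟨ cong₂ _+_ (scaled-average 20)
      (trans (scaled-average 20) (sum-permute (λ y → 20 * S y) (∙-permutation g))) ⟩
    ∑[ y < N ] (20 * S y) + ∑[ y < N ] (20 * S (y ∙ g))        ≡⟨ ∑-distrib-+ (λ y → 20 * S y) (λ y → 20 * S (y ∙ g)) ⟨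
    ∑[ y < N ] (20 * S y + 20 * S (y ∙ g))                     ≤⟨ ∑-≤-const (λ y → pair y (commute? y)) ⟩
    N * (10 * (n * N))                                         ≡⟨ identity₂ N n ⟩
    n * (10 * (N * N))                                         ∎))
    where
    open ≤-Reasoning
    identity₁ : ∀ n p → n * (10 * (4 * p)) ≡ n * (20 * p) + n * (20 * p)
    identity₁ = solve-∀
    identity₂ : ∀ N n → N * (10 * (n * N)) ≡ n * (10 * (N * N))
    identity₂ = solve-∀
    add : ∀ {a b a′ b′} → a ≤ a′ * (n * N) → b ≤ b′ * (n * N) → a + b ≤ (a′ + b′) * (n * N)
    add {a′ = a′} {b′} p q = ≤-trans (+-mono-≤ p q) (≤-reflexive (sym (*-distribʳ-+ (n * N) a′ b′)))
    quotient-commutes : ∀ {y} → Commute y z → Commute (y ∙ g) z → Commute g z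
    quotient-commutes {y} yz ygz = ∙-cancelˡ y _ _ (trans (sym (assoc y g z)) (trans ygz
      (trans (sym (assoc z y g)) (trans (cong (_∙ g) (sym yz)) (assoc y z g)))))
    pair : ∀ y → Dec (Commute y z) → 20 * S y + 20 * S (y ∙ g) ≤ 10 * (n * N)
    pair y (no ¬yz) = add {a′ = 4} {6} (noncommuting-20S≤ ¬yz) (20S≤ {6} (m≤m+n 4 2) 2κ≤ (y ∙ g))
    pair y (yes yz) = add {a′ = 6} {4} (commuting-20S≤ {6} 2κ≤ yz)
                     (noncommuting-20S≤ {y ∙ g} λ ygz → ¬gz (quotient-commutes {y} yz ygz))

  roots : ℕ → ℕ
  roots l = ∑[ y < N ] 𝟙 (pow y l ≟ᶠ ε)

  -- The powers `pow x (a * i)` with `i < l` form the subgroup of order `l` of ⟨ `x` ⟩.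
  roots≥ : ∀ a l .{{_ : NonZero a}} → o x ≡ a * l → l ≤ roots l
  roots≥ a l o≡ = injection⇒≤-count (λ y → pow y l ≟ᶠ ε) {λ i → pow x (a * toℕ i)}
    (λ {i} {j} eq → Fin.toℕ-injective (*-cancelˡ-≡ (toℕ i) (toℕ j) a (pow-injective x (below i) (below j) eq)))
    (λ i → trans (sym (pow-* x (a * toℕ i) l)) (pow-∣ {x} {o x}
      (subst₂ _∣_ (sym o≡) (identity a (toℕ i) l) (m∣m*n (toℕ i))) (pow-ord x)))
    where
    identity : ∀ a i l → a * l * i ≡ a * i * l
    identity = solve-∀
    below : ∀ (i : Fin l) → a * toℕ i < o x
    below i = subst (a * toℕ i <_) (sym o≡) (*-monoʳ-< a (Fin.toℕ<n i))

  module Central (central : ∀ y → Commute y z) (2κ≤6n : 2 * κ ≤ 6 * n) where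

    40S≤ : ∀ y → 40 * S y ≤ 12 * (n * N)
    40S≤ y = begin
      40 * S y              ≡⟨ *-assoc 2 20 (S y) ⟩
      2 * (20 * S y)        ≤⟨ *-monoʳ-≤ 2 (commuting-20S≤ {6} 2κ≤6n (central y)) ⟩
      2 * (6 * (n * N))     ≡⟨ *-assoc 2 6 (n * N) ⟨
      12 * (n * N)          ∎
      where open ≤-Reasoning

    root-40S≤ : ∀ {y l} → n ∣ l → 1 ≤ l → pow y l ≡ ε → 40 * S y ≤ 24 * (n * l)
    root-40S≤ {y} {l} n∣l 1≤l yˡ≡ε = begin
      40 * S y              ≡⟨ *-assoc 8 5 (S y) ⟩
      8 * (5 * S y)         ≤⟨ *-monoʳ-≤ 8 (commuting-root-S≤ (central y) n∣l 1≤l yˡ≡ε) ⟩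
      8 * (κ * l)           ≡⟨ identity₁ κ l ⟩
      2 * κ * (4 * l)       ≤⟨ *-monoˡ-≤ (4 * l) 2κ≤6n ⟩
      6 * n * (4 * l)       ≡⟨ identity₂ n l ⟩
      24 * (n * l)          ∎
      where
      open ≤-Reasoning
      identity₁ : ∀ κ l → 8 * (κ * l) ≡ 2 * κ * (4 * l)
      identity₁ = solve-∀
      identity₂ : ∀ n l → 6 * n * (4 * l) ≡ 24 * (n * l)
      identity₂ = solve-∀

    -- A root of exponent l = N / 4 has 40 S ≤ 24 n l = 6 n N, which saves 6 n N against the general
    -- 12 n N, and there are at least N / 4 roots. The saving is added on the left, weighted by the
    -- indicator `T`, to avoid subtraction.
    80ψ≤21N² : ∀ {l} → N ≡ 4 * l → o x ≡ 2 * l → n ∣ l → 1 ≤ l → 80 * ψ G ≤ 21 * (N * N)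
    80ψ≤21N² {l} N≡ o≡ n∣l 1≤l = *-cancelˡ-≤ 2 (+-cancelʳ-≤ (6 * (N * N)) _ _ (*-cancelˡ-≤ n {{n≢0}} (begin
      n * (2 * (80 * ψ G) + 6 * (N * N))                ≡⟨ identity₁ n (ψ G) N ⟩
      4 * (n * (40 * ψ G)) + n * N * 6 * N               ≡⟨ cong (λ a → 4 * (n * (40 * ψ G)) + n * N * 6 * a) N≡ ⟩
      4 * (n * (40 * ψ G)) + n * N * 6 * (4 * l)         ≤⟨ +-monoʳ-≤ (4 * (n * (40 * ψ G))) (*-monoʳ-≤ (n * N * 6) (*-monoʳ-≤ 4 (roots≥ 2 l o≡))) ⟩
      4 * (n * (40 * ψ G)) + n * N * 6 * (4 * roots l)   ≡⟨ identity₂ (n * (40 * ψ G)) (n * N * 6) (roots l) ⟩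
      4 * (n * (40 * ψ G) + n * N * 6 * roots l)         ≡⟨ cong (4 *_) (cong₂ _+_ (scaled-average 40) (∑-scale (n * N * 6) T)) ⟩
      4 * (∑[ y < N ] (40 * S y) + ∑[ y < N ] (n * N * 6 * T y)) ≡⟨ cong (4 *_) (∑-distrib-+ (λ y → 40 * S y) (λ y → n * N * 6 * T y)) ⟨
      4 * ∑[ y < N ] (40 * S y + n * N * 6 * T y)        ≤⟨ *-monoʳ-≤ 4 (∑-≤-const λ y → pointwise y (pow y l ≟ᶠ ε)) ⟩
      4 * (N * (12 * (n * N)))                           ≡⟨ identity₃ n N ⟩
      n * (2 * (21 * (N * N)) + 6 * (N * N))             ∎)))
      where
      open ≤-Reasoning
      T : Fin N → ℕ
      T y = 𝟙 (pow y l ≟ᶠ ε)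
      identity₁ : ∀ n p N → n * (2 * (80 * p) + 6 * (N * N)) ≡ 4 * (n * (40 * p)) + n * N * 6 * N
      identity₁ = solve-∀
      identity₂ : ∀ a b t → 4 * a + b * (4 * t) ≡ 4 * (a + b * t)
      identity₂ = solve-∀
      identity₃ : ∀ n N → 4 * (N * (12 * (n * N))) ≡ n * (2 * (21 * (N * N)) + 6 * (N * N))
      identity₃ = solve-∀
      identity₄ : ∀ n l → 24 * (n * l) + n * (4 * l) * 6 * 1 ≡ 12 * (n * (4 * l))
      identity₄ = solve-∀
      pointwise : ∀ y (root? : Dec (pow y l ≡ ε)) → 40 * S y + n * N * 6 * 𝟙 root? ≤ 12 * (n * N)
      pointwise y (yes yˡ≡ε) = begin
        40 * S y + n * N * 6 * 1                ≤⟨ +-monoˡ-≤ _ (root-40S≤ n∣l 1≤l yˡ≡ε) ⟩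
        24 * (n * l) + n * N * 6 * 1            ≡⟨ cong (λ a → 24 * (n * l) + n * a * 6 * 1) N≡ ⟩
        24 * (n * l) + n * (4 * l) * 6 * 1      ≡⟨ identity₄ n l ⟩
        12 * (n * (4 * l))                      ≡⟨ cong (λ a → 12 * (n * a)) N≡ ⟨
        12 * (n * N)                            ∎
      pointwise y (no _) = subst (_≤ 12 * (n * N)) (sym (trans (cong (λ s → 40 * S y + s) (*-zeroʳ (n * N * 6))) (+-identityʳ _))) (40S≤ y)

    -- The savings are nested: 6 n N for each of at least 2 l roots of exponent 2 l = N / 4, and a
    -- further 3 n N for each of at least l roots of exponent l = N / 8.
    320ψ≤81N² : ∀ {l} → N ≡ 8 * l → o x ≡ 4 * l → n ∣ l → 1 ≤ l → 320 * ψ G ≤ 81 * (N * N)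
    320ψ≤81N² {l} N≡ o≡ n∣l 1≤l = +-cancelʳ-≤ (15 * (N * N)) _ _ (*-cancelˡ-≤ n {{n≢0}} (begin
      n * (320 * ψ G + 15 * (N * N))
        ≡⟨ identity₁ n (ψ G) N ⟩
      8 * (n * (40 * ψ G)) + n * N * 15 * N
        ≡⟨ cong (λ a → 8 * (n * (40 * ψ G)) + n * N * 15 * a) N≡ ⟩
      8 * (n * (40 * ψ G)) + n * N * 15 * (8 * l)
        ≡⟨ identity₂ (n * (40 * ψ G)) (n * N) l ⟩
      8 * (n * (40 * ψ G) + (n * N * 6 * (2 * l) + n * N * 3 * l))
        ≤⟨ *-monoʳ-≤ 8 (+-monoʳ-≤ (n * (40 * ψ G)) (+-mono-≤
             (*-monoʳ-≤ (n * N * 6) (roots≥ 2 (2 * l) (trans o≡ (*-assoc 2 2 l))))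
             (*-monoʳ-≤ (n * N * 3) (roots≥ 4 l o≡)))) ⟩
      8 * (n * (40 * ψ G) + (n * N * 6 * roots (2 * l) + n * N * 3 * roots l))
        ≡⟨ cong (8 *_) (cong₂ _+_ (scaled-average 40) (cong₂ _+_ (∑-scale (n * N * 6) T₁) (∑-scale (n * N * 3) T₂))) ⟩
      8 * (∑[ y < N ] (40 * S y) + (∑[ y < N ] (n * N * 6 * T₁ y) + ∑[ y < N ] (n * N * 3 * T₂ y)))
        ≡⟨ cong (λ a → 8 * (∑[ y < N ] (40 * S y) + a)) (∑-distrib-+ (λ y → n * N * 6 * T₁ y) (λ y → n * N * 3 * T₂ y)) ⟨
      8 * (∑[ y < N ] (40 * S y) + ∑[ y < N ] (n * N * 6 * T₁ y + n * N * 3 * T₂ y))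
        ≡⟨ cong (8 *_) (∑-distrib-+ (λ y → 40 * S y) (λ y → n * N * 6 * T₁ y + n * N * 3 * T₂ y)) ⟨
      8 * ∑[ y < N ] (40 * S y + (n * N * 6 * T₁ y + n * N * 3 * T₂ y))
        ≤⟨ *-monoʳ-≤ 8 (∑-≤-const λ y → pointwise y (pow y (2 * l) ≟ᶠ ε) (pow y l ≟ᶠ ε)) ⟩
      8 * (N * (12 * (n * N)))
        ≡⟨ identity₃ n N ⟩
      n * (81 * (N * N) + 15 * (N * N)) ∎))
      where
      open ≤-Reasoning
      T₁ T₂ : Fin N → ℕ
      T₁ y = 𝟙 (pow y (2 * l) ≟ᶠ ε)
      T₂ y = 𝟙 (pow y l ≟ᶠ ε)
      identity₁ : ∀ n p N → n * (320 * p + 15 * (N * N)) ≡ 8 * (n * (40 * p)) + n * N * 15 * N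
      identity₁ = solve-∀
      identity₂ : ∀ a b l → 8 * a + b * 15 * (8 * l) ≡ 8 * (a + (b * 6 * (2 * l) + b * 3 * l))
      identity₂ = solve-∀
      identity₃ : ∀ n N → 8 * (N * (12 * (n * N))) ≡ n * (81 * (N * N) + 15 * (N * N))
      identity₃ = solve-∀
      identity₄ : ∀ n l → 24 * (n * (2 * l)) + (n * (8 * l) * 6 * 1 + 0) ≡ 12 * (n * (8 * l))
      identity₄ = solve-∀
      identity₅ : ∀ n l → 24 * (n * l) + (n * (8 * l) * 6 * 1 + n * (8 * l) * 3 * 1) ≡ 12 * (n * (8 * l))
      identity₅ = solve-∀
      pointwise : ∀ y (root₁? : Dec (pow y (2 * l) ≡ ε)) (root₂? : Dec (pow y l ≡ ε)) →
                  40 * S y + (n * N * 6 * 𝟙 root₁? + n * N * 3 * 𝟙 root₂?) ≤ 12 * (n * N)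
      pointwise y (no ¬y²ˡ≡ε) (yes yˡ≡ε) = contradiction (pow-∣ {y} {l} (n∣m*n 2) yˡ≡ε) ¬y²ˡ≡ε
      pointwise y (yes _) (yes yˡ≡ε) = begin
        40 * S y + (n * N * 6 * 1 + n * N * 3 * 1)                      ≤⟨ +-monoˡ-≤ _ (root-40S≤ n∣l 1≤l yˡ≡ε) ⟩
        24 * (n * l) + (n * N * 6 * 1 + n * N * 3 * 1)                  ≡⟨ cong (λ a → 24 * (n * l) + (n * a * 6 * 1 + n * a * 3 * 1)) N≡ ⟩
        24 * (n * l) + (n * (8 * l) * 6 * 1 + n * (8 * l) * 3 * 1)      ≡⟨ identity₅ n l ⟩
        12 * (n * (8 * l))                                              ≡⟨ cong (λ a → 12 * (n * a)) N≡ ⟨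
        12 * (n * N)                                                    ∎
      pointwise y (yes y²ˡ≡ε) (no _) = begin
        40 * S y + (n * N * 6 * 1 + n * N * 3 * 0)      ≡⟨ cong (λ a → 40 * S y + (n * N * 6 * 1 + a)) (*-zeroʳ (n * N * 3)) ⟩
        40 * S y + (n * N * 6 * 1 + 0)                  ≤⟨ +-monoˡ-≤ _ (root-40S≤ (∣n⇒∣m*n 2 n∣l) (≤-trans 1≤l (m≤n*m l 2)) y²ˡ≡ε) ⟩
        24 * (n * (2 * l)) + (n * N * 6 * 1 + 0)        ≡⟨ cong (λ a → 24 * (n * (2 * l)) + (n * a * 6 * 1 + 0)) N≡ ⟩
        24 * (n * (2 * l)) + (n * (8 * l) * 6 * 1 + 0)  ≡⟨ identity₄ n l ⟩
        12 * (n * (8 * l))                              ≡⟨ cong (λ a → 12 * (n * a)) N≡ ⟨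
        12 * (n * N)                                    ∎
      pointwise y (no _) (no _) = subst (_≤ 12 * (n * N)) (sym (trans (cong (λ s → 40 * S y + s)
              (cong₂ _+_ (*-zeroʳ (n * N * 6)) (*-zeroʳ (n * N * 3)))) (+-identityʳ _))) (40S≤ y)

-- Passing from ord x > |G| / 4 to a cyclic subgroup of index 2 or 3

module SmallIndex {e n : ℕ} (G : FinGroup (e * n)) (¬cyclic : ¬ Cyclic G) (1<n : 1 < n)
  (e⊥n : Coprime e n) (divisor≥5 : ∀ {d} → d ∣ n → d ≢ 1 → 5 ≤ d) where

  open Orders G

  private
    N : ℕ
    N = e * n

  LargeCyclic : Set
  LargeCyclic = ∃ λ x → ∃ λ k → ∃ λ m → o x ≡ m * n × k * m ≡ e × (k ≡ 2 ⊎ k ≡ 3)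

  small-orders : (∀ x → 4 * o x ≤ N) → 4 * ψ G ≤ N * N
  small-orders 4o≤N = begin
    4 * ψ G                  ≡⟨ cong (4 *_) (∑-list o) ⟩
    4 * sum o                ≡⟨ ∑-scale 4 o ⟩
    ∑[ x < N ] (4 * o x)     ≤⟨ ∑-≤-const 4o≤N ⟩
    N * N                    ∎
    where open ≤-Reasoning

  2⊎3⇒≥1 : ∀ {k} → k ≡ 2 ⊎ k ≡ 3 → 1 ≤ k
  2⊎3⇒≥1 (inj₁ refl) = s≤s z≤n
  2⊎3⇒≥1 (inj₂ refl) = s≤s z≤n

  2⊎3⇒≤3 : ∀ {k} → k ≡ 2 ⊎ k ≡ 3 → k ≤ 3
  2⊎3⇒≤3 (inj₁ refl) = n≤1+n 2
  2⊎3⇒≤3 (inj₂ refl) = ≤-refl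

  -- `n` divides `k * o x` and is prime to `k`, so it divides `o x`; the quotient is `m`.
  small-index : ∀ x k → N ≡ k * o x → k ≡ 2 ⊎ k ≡ 3 → LargeCyclic
  small-index x k N≡ k≡2⊎3 with divides m o≡ ← coprime-divisor (≤3⇒coprime divisor≥5 (2⊎3⇒≥1 k≡2⊎3) (2⊎3⇒≤3 k≡2⊎3))
                                                (divides e (sym N≡)) =
    x , k , m , o≡ , *-cancelʳ-≡ (k * m) e n {{>-nonZero (<⇒≤ 1<n)}}
      (trans (*-assoc k m n) (trans (cong (k *_) (sym o≡)) (sym N≡))) , k≡2⊎3

  large-order : ∀ x → N < 4 * o x → LargeCyclic
  large-order x N<4o with divides k N≡ ← lagrange x = index k N≡
    where
    2o≤N = noncyclic⇒2ord≤N ¬cyclic x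
    index : ∀ k → N ≡ k * o x → LargeCyclic
    index 0 N≡ = contradiction (subst (2 * o x ≤_) N≡ 2o≤N) (<⇒≱ (*-monoʳ-< 2 (ord≥1 x)))
    index 1 N≡ = contradiction (subst (2 * o x ≤_) N≡ 2o≤N)
                   (<⇒≱ (*-monoˡ-< (o x) {{ord-nonZero {x}}} (n<1+n 1)))
    index 2 N≡ = small-index x 2 N≡ (inj₁ refl)
    index 3 N≡ = small-index x 3 N≡ (inj₂ refl)
    index k@(suc (suc (suc (suc l)))) N≡ = contradiction
      (subst (4 * o x ≤_) (sym N≡) (*-monoˡ-≤ (o x) (m≤m+n 4 l))) (<⇒≱ N<4o)

  small-ψ-or-large : 4 * ψ G ≤ N * N ⊎ LargeCyclic
  small-ψ-or-large with Fin.any? (λ x → N <? 4 * o x)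
  ... | yes (x , N<4o) = inj₂ (large-order x N<4o)
  ... | no  none       = inj₁ (small-orders λ x → ≮⇒≥ (λ N<4o → none (x , N<4o)))

  card-from : ∀ {k m} → k * m ≡ e → k * (m * n) ≡ N
  card-from {k} {m} km≡e = trans (sym (*-assoc k m n)) (cong (_* n) km≡e)

  coprime-from : ∀ {k m} → k * m ≡ e → Coprime m n
  coprime-from {k} km≡e {d} (d∣m , d∣n) = e⊥n (subst (d ∣_) km≡e (∣n⇒∣m*n k d∣m) , d∣n)

  module FromLarge (x : Fin N) (k m : ℕ) (o≡ : ord G x ≡ m * n) (km≡e : k * m ≡ e) (k≤3 : k ≤ 3) =
    Bounds G ¬cyclic x k m n o≡ (card-from {k} {m} km≡e) k≤3 1<n (coprime-from {k} {m} km≡e) divisor≥5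

  weaken : ∀ {c d} → c ≤ d → 4 * ψ G ≤ N * N → c * 4 * ψ G ≤ d * (N * N)
  weaken {c} {d} c≤d 4ψ≤ = subst (_≤ d * (N * N)) (sym (*-assoc c 4 (ψ G))) (*-mono-≤ c≤d 4ψ≤)

  20ψ≤ : ∀ r → 5 ≤ r → 2 * (4 * φ n + n) ≤ r * n → 20 * ψ G ≤ r * (N * N)
  20ψ≤ r 5≤r 2κ≤ = split small-ψ-or-large
    where
    split : 4 * ψ G ≤ N * N ⊎ LargeCyclic → 20 * ψ G ≤ r * (N * N)
    split (inj₁ 4ψ≤) = weaken {5} {r} 5≤r 4ψ≤
    split (inj₂ (x , k , m , o≡ , km≡e , k≡2⊎3)) =
      FromLarge.20ψ≤ x k m o≡ km≡e (2⊎3⇒≤3 k≡2⊎3) {r} (≤-trans (n≤1+n 4) 5≤r) 2κ≤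

  Central₂ : Set
  Central₂ = ∃ λ x → ∃ λ m → o x ≡ m * n × 2 * m ≡ e × (∀ y → Commute y (pow x m))

  -- Index 3 would put a factor 3 into `e`. With index 2, an element that does not commute with
  -- `pow x m` already forces the bound 1/4.
  small-ψ-or-central : 3 ∤ e → 2 * (4 * φ n + n) ≤ 6 * n → 4 * ψ G ≤ N * N ⊎ Central₂
  small-ψ-or-central 3∤e 2κ≤ = split small-ψ-or-large
    where
    split : 4 * ψ G ≤ N * N ⊎ LargeCyclic → 4 * ψ G ≤ N * N ⊎ Central₂
    split (inj₁ 4ψ≤) = inj₁ 4ψ≤
    split (inj₂ (x , k , m , o≡ , km≡e , inj₂ refl)) = contradiction (subst (3 ∣_) km≡e (m∣m*n m)) 3∤e
    split (inj₂ (x , k , m , o≡ , km≡e , inj₁ refl)) = decide (Fin.all? commute?)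
      where
      open FromLarge x 2 m o≡ km≡e (n≤1+n 2)
      decide : Dec (∀ y → Commute y (pow x m)) → 4 * ψ G ≤ N * N ⊎ Central₂
      decide (yes central)  = inj₂ (x , m , o≡ , km≡e , central)
      decide (no  ¬central) = let g , ¬gz = Fin.¬∀⟶∃¬ N _ commute? ¬central
                              in inj₁ (noncentral-4ψ≤ ¬gz 2κ≤)

  private
    N≢0 : NonZero N
    N≢0 = Fin.nonZeroIndex ε

    half : ∀ {x m l} → o x ≡ m * n → 2 * m ≡ e → N ≡ 2 * l → o x ≡ l
    half {x} {m} {l} o≡ 2m≡e N≡ = *-cancelˡ-≡ (o x) l 2
      (trans (cong (2 *_) o≡) (trans (sym (*-assoc 2 m n)) (trans (cong (_* n) 2m≡e) N≡)))

    factor≥1 : ∀ c {l} → N ≡ c * l → 1 ≤ l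
    factor≥1 c {l} N≡ = >-nonZero⁻¹ l {{m*n≢0⇒n≢0 c {{subst NonZero N≡ N≢0}}}}

  80ψ≤21N² : 3 ∤ e → 2 * (4 * φ n + n) ≤ 6 * n → ∀ {l} → N ≡ 4 * l → n ∣ l → 80 * ψ G ≤ 21 * (N * N)
  80ψ≤21N² 3∤e 2κ≤ {l} N≡ n∣l = split (small-ψ-or-central 3∤e 2κ≤)
    where
    split : 4 * ψ G ≤ N * N ⊎ Central₂ → 80 * ψ G ≤ 21 * (N * N)
    split (inj₁ 4ψ≤) = weaken {20} {21} (n≤1+n 20) 4ψ≤
    split (inj₂ (x , m , o≡ , 2m≡e , central)) =
      FromLarge.Central.80ψ≤21N² x 2 m o≡ 2m≡e (n≤1+n 2) central 2κ≤ N≡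
        (half {m = m} o≡ 2m≡e (trans N≡ (*-assoc 2 2 l))) n∣l (factor≥1 4 N≡)

  320ψ≤81N² : 3 ∤ e → 2 * (4 * φ n + n) ≤ 6 * n → ∀ {l} → N ≡ 8 * l → n ∣ l → 320 * ψ G ≤ 81 * (N * N)
  320ψ≤81N² 3∤e 2κ≤ {l} N≡ n∣l = split (small-ψ-or-central 3∤e 2κ≤)
    where
    split : 4 * ψ G ≤ N * N ⊎ Central₂ → 320 * ψ G ≤ 81 * (N * N)
    split (inj₁ 4ψ≤) = weaken {80} {81} (n≤1+n 80) 4ψ≤
    split (inj₂ (x , m , o≡ , 2m≡e , central)) =
      FromLarge.Central.320ψ≤81N² x 2 m o≡ 2m≡e (n≤1+n 2) central 2κ≤ N≡
        (half {m = m} o≡ 2m≡e (trans N≡ (*-assoc 2 4 l))) n∣l (factor≥1 8 N≡)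

-- Comparing ψ'' with rational thresholds

ψ''>⇒ : ∀ {m} (G : FinGroup m) a b .{{_ : NonZero b}} → ψ'' G ℚ.> + a / b → a * (m * m) < b * ψ G
ψ''>⇒ {zero}  G a b       _  with () ← FinGroup.ε G
-- Both fractions are traded for the unnormalised ones that they reduce, where the order is
-- cross-multiplication.
ψ''>⇒ {suc m} G a (suc b) ψ> = subst₂ _<_ (cong (λ l → a * (suc m * l)) (*-identityʳ (suc m))) (*-comm (ψ G) (suc b))
  (ℤ.drop‿+<+ (subst₂ ℤ._<_ (sym (ℤ.pos-* a (suc m ^ 2))) (sym (ℤ.pos-* (ψ G) (suc b)))
    (ℚᵘ.drop-*<* (ℚᵘ.<-respˡ-≃ (ℚ.toℚᵘ-fromℚᵘ (ℚᵘ.mkℚᵘ (+ a) b))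
      (ℚᵘ.<-respʳ-≃ (ℚ.toℚᵘ-fromℚᵘ (ℚᵘ.mkℚᵘ (+ ψ G) (pred (suc m ^ 2)))) (ℚ.toℚᵘ-mono-< ψ>))))))

≤-+-/ : ∀ p d .{{_ : NonZero d}} → p ℚ.≤ p ℚ.+ + 1 / d
≤-+-/ p d = subst (ℚ._≤ p ℚ.+ + 1 / d) (ℚ.+-identityʳ p)
  (ℚ.+-monoʳ-≤ p (ℚ.nonNegative⁻¹ (+ 1 / d) {{ℚ.normalize-nonNeg 1 d}}))

-- 16 / 63 is the limit of the thresholds in (iv) as α grows, and 81/320 lies just below it.
16/63≤boundIV : ∀ α → + 16 / 63 ℚ.≤ boundIV α
16/63≤boundIV α = ≤-+-/ (+ 16 / 63) (9 * 2 ^ (2 * α ∸ 1))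
  {{m*n≢0 9 (2 ^ (2 * α ∸ 1)) {{_}} {{m^n≢0 2 (2 * α ∸ 1)}}}}

-- In fractions: a / b < ψ'' ≤ d / c ≤ a / b.
ψ-bounds-contradict : ∀ {m} (G : FinGroup m) a b c d .{{_ : NonZero c}} →
  a * (m * m) < b * ψ G → c * ψ G ≤ d * (m * m) → d * b ≤ c * a → ⊥
ψ-bounds-contradict {m} G a b c d above below db≤ca = <-irrefl refl (begin-strict
  c * (a * (m * m))   <⟨ *-monoʳ-< c above ⟩
  c * (b * ψ G)       ≡⟨ identity c b (ψ G) ⟩
  b * (c * ψ G)       ≤⟨ *-monoʳ-≤ b below ⟩
  b * (d * (m * m))   ≡⟨ trans (identity b d (m * m)) (sym (*-assoc d b (m * m))) ⟩
  d * b * (m * m)     ≤⟨ *-monoˡ-≤ (m * m) db≤ca ⟩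
  c * a * (m * m)     ≡⟨ *-assoc c a (m * m) ⟩
  c * (a * (m * m))   ∎)
  where
  open ≤-Reasoning
  identity : ∀ a b c → a * (b * c) ≡ b * (a * c)
  identity = solve-∀

-- Groups of order 2 ^ α * n under Lehmer's equation

module Orders-2^α*n {n k : ℕ} (car : Carmichael n) (k≥2 : k ≥ 2) (kφ≡ : suc (k * φ n) ≡ n) where

  private
    instance
      n≢0 : NonZero n
      n≢0 = >-nonZero (<⇒≤ (nonTrivial⇒n>1 n {{composite⇒nonTrivial (proj₁ car)}}))
    sf = carmichael⇒squarefree car
    2∤n = carmichael⇒odd car

  -- For n = 3 m the factor 3 is moved into the cofactor 2 ^ α * 3, leaving `m` prime to 6, and 8
  -- φ(m) ≤ 3 m yields r = 5, that is 5/20 = 1/4. `N` is a variable because the two factorisations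
  -- of the order agree only propositionally while `FinGroup` depends on it.
  multiple-of-3 : 3 ∣ n → ∀ {N} α → N ≡ 2 ^ α * n → (G : FinGroup N) → ¬ Cyclic G → 4 * ψ G ≤ N * N
  multiple-of-3 (divides m refl) {N} α N≡ G ¬cyclic = go G ¬cyclic (trans N≡ (identity₁ (2 ^ α) m))
    where
    identity₁ : ∀ a m → a * (m * 3) ≡ a * 3 * m
    identity₁ = solve-∀
    m≢0 : NonZero m
    m≢0 = m*n≢0⇒m≢0 m
    2∤m : 2 ∤ m
    2∤m 2∣m = 2∤n (∣m⇒∣m*n 3 2∣m)
    3∤m : 3 ∤ m
    3∤m 3∣m = sf 3-prime (*-monoˡ-∣ 3 3∣m)
    8φ≤3m : 8 * φ m ≤ 3 * m
    8φ≤3m = lehmer-multiple-of-3 {k} {m} (subst Squarefree (*-comm m 3) sf) k≥2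
              (subst (λ l → suc (k * φ l) ≡ l) (*-comm m 3) kφ≡)
    1<m : 1 < m
    -- For m = 1 the inequality would read 8 ≤ 3.
    1<m = ≤∧≢⇒< (>-nonZero⁻¹ m {{m≢0}}) λ { refl → contradiction 8φ≤3m (<⇒≱ (m≤m+n 4 4)) }
    2κ≤5m : 2 * (4 * φ m + m) ≤ 5 * m
    2κ≤5m = subst₂ _≤_ (identity₂ (φ m) m) (identity₃ m) (+-monoˡ-≤ (2 * m) 8φ≤3m)
      where
      identity₂ : ∀ a m → 8 * a + 2 * m ≡ 2 * (4 * a + m)
      identity₂ = solve-∀
      identity₃ : ∀ m → 3 * m + 2 * m ≡ 5 * m
      identity₃ = solve-∀
    e⊥m : Coprime (2 ^ α * 3) m
    e⊥m = Coprimality.sym (coprime-* (odd⇒coprime-2^ 2∤m α) (prime∤⇒coprime 3-prime 3∤m))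
    go : ∀ {N} (G : FinGroup N) → ¬ Cyclic G → N ≡ 2 ^ α * 3 * m → 4 * ψ G ≤ N * N
    go G ¬cyclic refl = *-cancelˡ-≤ 5 (subst (_≤ 5 * (N′ * N′)) (*-assoc 5 4 (ψ G))
      (SmallIndex.20ψ≤ G ¬cyclic 1<m e⊥m (coprime-6⇒divisor≥5 {{m≢0}} 2∤m 3∤m) 5 ≤-refl 2κ≤5m))
      where N′ = 2 ^ α * 3 * m

  module _ (3∤n : 3 ∤ n) α (G : FinGroup (2 ^ α * n)) (¬cyclic : ¬ Cyclic G) where

    private
      N : ℕ
      N = 2 ^ α * n
      2κ≤6n : 2 * (4 * φ n + n) ≤ 6 * n
      -- From 2 φ(n) ≤ k φ(n) < n, that is κ ≤ 3 n.
      2κ≤6n = begin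
        2 * (4 * φ n + n)        ≡⟨ identity₁ (φ n) n ⟩
        4 * (2 * φ n) + 2 * n    ≤⟨ +-monoˡ-≤ (2 * n) (*-monoʳ-≤ 4 (*-monoˡ-≤ (φ n) k≥2)) ⟩
        4 * (k * φ n) + 2 * n    ≤⟨ +-monoˡ-≤ (2 * n) (*-monoʳ-≤ 4 (≤-trans (n≤1+n (k * φ n)) (≤-reflexive kφ≡))) ⟩
        4 * n + 2 * n            ≡⟨ *-distribʳ-+ n 4 2 ⟨
        6 * n                    ∎
        where
        open ≤-Reasoning
        identity₁ : ∀ a n → 2 * (4 * a + n) ≡ 4 * (2 * a) + 2 * n
        identity₁ = solve-∀
      3∤2^α : 3 ∤ 2 ^ α
      3∤2^α 3∣2^α = contradiction (odd⇒coprime-2^ {3} (λ { (divides (suc zero) ()) ; (divides (suc (suc _)) ()) }) α (∣-refl , 3∣2^α)) λ ()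
      open SmallIndex G ¬cyclic (nonTrivial⇒n>1 n {{composite⇒nonTrivial (proj₁ car)}})
        (Coprimality.sym (odd⇒coprime-2^ 2∤n α)) (coprime-6⇒divisor≥5 2∤n 3∤n)

    10ψ≤3N² : 10 * ψ G ≤ 3 * (N * N)
    10ψ≤3N² = *-cancelˡ-≤ 2 (subst₂ _≤_ (*-assoc 2 10 (ψ G)) (*-assoc 2 3 (N * N))
      (20ψ≤ 6 (n≤1+n 5) 2κ≤6n))

    4∣2^α⇒80ψ≤ : ∀ {a} → 2 ^ α ≡ 4 * a → 80 * ψ G ≤ 21 * (N * N)
    4∣2^α⇒80ψ≤ {a} eq = 80ψ≤21N² 3∤2^α 2κ≤6n (trans (cong (_* n) eq) (*-assoc 4 a n)) (n∣m*n a)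

    8∣2^α⇒320ψ≤ : ∀ {a} → 2 ^ α ≡ 8 * a → 320 * ψ G ≤ 81 * (N * N)
    8∣2^α⇒320ψ≤ {a} eq = 320ψ≤81N² 3∤2^α 2κ≤6n (trans (cong (_* n) eq) (*-assoc 8 a n)) (n∣m*n a)

theorem3p1 : (n : ℕ) → Carmichael n →
    ( NoncyclicAbove (2 * n) (+ 13 / 42)
    ⊎ NoncyclicAbove (4 * n) (+ 7 / 24)
    ⊎ NoncyclicAbove (8 * n) (+ 9 / 32)
    ⊎ (Σ ℕ λ α → α ≥ 4 × NoncyclicAbove (2 ^ α * n) (boundIV α)) ) →
    ¬ (∃ λ k → k ≥ 2 × k * φ n ≡ n ∸ 1)
theorem3p1 n car groups (k , k≥2 , kφ≡n-1) = refute (3 ∣? n) groups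
  where
  open Orders-2^α*n car k≥2 (trans (cong suc kφ≡n-1)
    (m+[n∸m]≡n (<⇒≤ (nonTrivial⇒n>1 n {{composite⇒nonTrivial (proj₁ car)}}))))
  above-16/63 : ∀ {m} α (G : FinGroup m) → ψ'' G ℚ.> boundIV α → 16 * (m * m) < 63 * ψ G
  above-16/63 α G ψ> = ψ''>⇒ G 16 63 (ℚ.≤-<-trans (16/63≤boundIV α) ψ>)

  4ψ≤ : 3 ∣ n → ∀ α (G : FinGroup (2 ^ α * n)) → ¬ Cyclic G → 4 * ψ G ≤ 1 * (2 ^ α * n * (2 ^ α * n))
  4ψ≤ 3∣n α G ¬cyclic = subst (4 * ψ G ≤_) (sym (*-identityˡ _)) (multiple-of-3 3∣n α refl G ¬cyclic)

  refute : Dec (3 ∣ n) →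
    ( NoncyclicAbove (2 * n) (+ 13 / 42)
    ⊎ NoncyclicAbove (4 * n) (+ 7 / 24)
    ⊎ NoncyclicAbove (8 * n) (+ 9 / 32)
    ⊎ (Σ ℕ λ α → α ≥ 4 × NoncyclicAbove (2 ^ α * n) (boundIV α)) ) → ⊥
  refute (yes 3∣n) (inj₁ (G , ¬cyclic , ψ>)) =
    ψ-bounds-contradict G 13 42 4 1 (ψ''>⇒ G 13 42 ψ>) (4ψ≤ 3∣n 1 G ¬cyclic) (m≤m+n 42 10)
  refute (yes 3∣n) (inj₂ (inj₁ (G , ¬cyclic , ψ>))) =
    ψ-bounds-contradict G 7 24 4 1 (ψ''>⇒ G 7 24 ψ>) (4ψ≤ 3∣n 2 G ¬cyclic) (m≤m+n 24 4)
  refute (yes 3∣n) (inj₂ (inj₂ (inj₁ (G , ¬cyclic , ψ>)))) =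
    ψ-bounds-contradict G 9 32 4 1 (ψ''>⇒ G 9 32 ψ>) (4ψ≤ 3∣n 3 G ¬cyclic) (m≤m+n 32 4)
  refute (yes 3∣n) (inj₂ (inj₂ (inj₂ (α , _ , G , ¬cyclic , ψ>)))) =
    ψ-bounds-contradict G 16 63 4 1 (above-16/63 α G ψ>) (4ψ≤ 3∣n α G ¬cyclic) (m≤m+n 63 1)
  refute (no 3∤n) (inj₁ (G , ¬cyclic , ψ>)) =
    ψ-bounds-contradict G 13 42 10 3 (ψ''>⇒ G 13 42 ψ>) (10ψ≤3N² 3∤n 1 G ¬cyclic) (m≤m+n 126 4)
  refute (no 3∤n) (inj₂ (inj₁ (G , ¬cyclic , ψ>))) =
    ψ-bounds-contradict G 7 24 80 21 (ψ''>⇒ G 7 24 ψ>)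
      (4∣2^α⇒80ψ≤ 3∤n 2 G ¬cyclic {1} refl) (m≤m+n 504 56)
  -- The estimate for multiples of 4 suffices here, since 21/80 < 9/32.
  refute (no 3∤n) (inj₂ (inj₂ (inj₁ (G , ¬cyclic , ψ>)))) =
    ψ-bounds-contradict G 9 32 80 21 (ψ''>⇒ G 9 32 ψ>)
      (4∣2^α⇒80ψ≤ 3∤n 3 G ¬cyclic {2} refl) (m≤m+n 672 48)
  -- The narrowest margin: 81 * 63 = 5103 against 320 * 16 = 5120.
  refute (no 3∤n) (inj₂ (inj₂ (inj₂ (α , α≥4 , G , ¬cyclic , ψ>)))) =
    ψ-bounds-contradict G 16 63 320 81 (above-16/63 α G ψ>)
      (8∣2^α⇒320ψ≤ 3∤n α G ¬cyclic {2 ^ (α ∸ 3)} 2^α≡) (m≤m+n 5103 17)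
    where
    2^α≡ : 2 ^ α ≡ 8 * 2 ^ (α ∸ 3)
    2^α≡ = trans (cong (2 ^_) (sym (m+[n∸m]≡n (≤-trans (n≤1+n 3) α≥4)))) (^-distribˡ-+-* 2 3 (α ∸ 3))
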